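{- For every octus $F$, we have $\text{mader}_{\vec{\chi}}(F)=v(F)$.
   Context: Digraphs are finite, have a nonempty vertex set, are loopless and have no parallel arcs, but may contain anti-parallel pairs of arcs $(x,y),(y,x)$ (digons). $v(D)$ denotes the number of vertices of a digraph $D$. An acyclic $k$-coloring of $D$ is a map $c:V(D)\to\{1,\dots,k\}$ such that each color class $c^{ -1}(i)$ induces an acyclic subdigraph (one with no directed cycle; a digon is a directed cycle of length 2). The dichromatic number $\vec{\chi}(D)$ is the smallest $k\in\mathbb{N}$ for which $D$ has an acyclic $k$-coloring. A subdivision of a digraph $F$ is any digraph obtained by replacing every arc $(x,y)$ of $F$ by a directed path from $x$ to $y$ (of length at least 1), where the subdivision paths of different arcs are internally vertex-disjoint (and their internal vertices are new vertices). A digraph $D$ contains a subdivision of $F$ if some subdigraph of $D$ is isomorphic to a subdivision of $F$. $\text{mader}_{\vec{\chi}}(F)$ denotes the smallest integer $k\ge 1$ such that every digraph $D$ with $\vec{\chi}(D)\ge k$ contains a subdivision of $F$ (it is known that such a $k$ exists for every digraph $F$). The class of octi (singular: octus) is defined inductively: (1) $K_1$ (the one-vertex digraph) is an octus. (2) (Ear addition) Let $F$ be an octus, $v_0\in V(F)$, and let $P=v_1,\dots,v_k$, $k\ge 1$, be an orientation of a path, vertex-disjoint from $F$ (each consecutive pair $v_i,v_{i+1}$ is joined by exactly one arc, in an arbitrary direction). Let $F^*$ be obtained from $F$ by adding $P$, both arcs $(v_0,v_1),(v_1,v_0)$, and exactly one of the arcs $(v_0,v_k),(v_k,v_0)$.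 Then $F^*$ is an octus. (For $k=1$ this just attaches a new vertex $v_1$ to $v_0$ by a digon.) (3) Every subdigraph of an octus is an octus. -}

module Defs where

open import Data.Bool using (Bool; true; false; T)
import Data.Bool.Properties as Bool
open import Data.Fin using (Fin; zero; suc; inject₁; fromℕ; splitAt; _≟_)
open import Data.Fin.Properties using (any?; suc-injective)
open import Data.List using (List; _∷_; _++_; _∷ʳ_)
open import Data.List.Membership.Propositional using (_∈_)
open import Data.List.Relation.Unary.All using (All)
open import Data.List.Relation.Unary.Linked using (Linked)
open import Data.List.Relation.Unary.Unique.Propositional using (Unique)
open import Data.Nat using (ℕ; suc; _+_; _≤_; NonZero)
open import Data.Product using (Σ; ∃; ∃-syntax; _×_; _,_)
open import Data.Sum using (_⊎_; inj₁; inj₂)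
open import Function.Definitions using (Injective)
open import Relation.Binary.PropositionalEquality using (_≡_; _≢_; refl; sym)
open import Relation.Nullary using (¬_; Dec; ⌊_⌋; _×-dec_; _⊎-dec_)
open import Relation.Nullary.Decidable using (toWitness)

-- Boolean adjacency makes `Arc` proof-irrelevant: there are no parallel arcs.

record Digraph : Set where
  field
    order        : ℕ
    {{nonempty}} : NonZero order
    arc          : Fin order → Fin order → Bool

  Vertex : Set
  Vertex = Fin order

  Arc : Vertex → Vertex → Set
  Arc x y = T (arc x y)

  field
    loopless : ∀ x → ¬ Arc x x

open Digraph public using (order; Vertex; Arc)

-- H is isomorphic to a (not necessarily induced) subdigraph of D.

record _⊑_ (H D : Digraph) : Set where
  field
    embed     : Vertex H → Vertex D
    injective : Injective _≡_ _≡_ embed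
    preserves : ∀ {x y} → Arc H x y → Arc D (embed x) (embed y)

-- Directed paths of length at least 1.

record Path (D : Digraph) (x y : Vertex D) : Set where
  field
    interior : List (Vertex D)

  vertices : List (Vertex D)
  vertices = x ∷ interior ∷ʳ y

  field
    linked   : Linked (Arc D) vertices
    distinct : Unique vertices

open Path public using (interior; vertices)

-- A directed cycle is a directed path from x to y closed by the arc (y , x).
-- The cycles of the subdigraph induced by P are the cycles of D inside P.

AcyclicOn : (D : Digraph) → (Vertex D → Set) → Set
AcyclicOn D P = ∀ {x y} (p : Path D x y) → All P (vertices p) → ¬ Arc D y x

AcyclicColoring : Digraph → ℕ → Set
AcyclicColoring D k =
  Σ (Vertex D → Fin k) λ c → ∀ i → AcyclicOn D (λ v → c v ≡ i)

IsLeast : (ℕ → Set) → ℕ → Set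
IsLeast P k = P k × (∀ j → P j → k ≤ j)

IsDichromaticNumber : Digraph → ℕ → Set
IsDichromaticNumber D = IsLeast (AcyclicColoring D)

-- S is, up to isomorphism, a subdivision of F.  The two covering conditions
-- say that S has nothing besides the subdivision paths.

record IsSubdivision (F S : Digraph) : Set where
  field
    branch           : Vertex F → Vertex S
    branch-injective : Injective _≡_ _≡_ branch
    path             : ∀ {x y} → Arc F x y → Path S (branch x) (branch y)
    interior-new     : ∀ {x y} (a : Arc F x y) {z} → z ∈ interior (path a) →
                       ∀ w → z ≢ branch w
    interior-disjoint : ∀ {x y x′ y′} (a : Arc F x y) (a′ : Arc F x′ y′) {z} →
                        z ∈ interior (path a) → z ∈ interior (path a′) →
                        x ≡ x′ × y ≡ y′
    vertex-covered   : ∀ z → (∃[ w ] z ≡ branch w) ⊎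
                       (∃[ x ] ∃[ y ] Σ (Arc F x y) λ a → z ∈ interior (path a))
    arc-covered      : ∀ {u v} → Arc S u v →
                       ∃[ x ] ∃[ y ] Σ (Arc F x y) λ a →
                       ∃[ us ] ∃[ vs ] vertices (path a) ≡ us ++ u ∷ v ∷ vs

ContainsSubdivision : Digraph → Digraph → Set
ContainsSubdivision D F = ∃[ S ] IsSubdivision F S × S ⊑ D

Forces : Digraph → ℕ → Set
Forces F k = ∀ D d → IsDichromaticNumber D d → k ≤ d → ContainsSubdivision D F

IsMaderNumber : Digraph → ℕ → Set
IsMaderNumber F = IsLeast (λ k → 1 ≤ k × Forces F k)

K₁ : Digraph
K₁ = record { order = 1 ; arc = λ _ _ → false ; loopless = λ _ () }

-- The added path has the k = suc m vertices v₁ , … , vₖ, numbered from zero.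
-- The edge between positions i and i + 1 points towards i + 1 iff
-- `forward i ≡ true`; the last arc is (v₀ , vₖ) if `out` is true and (vₖ , v₀) otherwise.

module EarAddition (F : Digraph) (v₀ : Vertex F)
                   (m : ℕ) (forward : Fin m → Bool) (out : Bool) where

  EarArc : Fin (suc m) ⊎ Vertex F → Fin (suc m) ⊎ Vertex F → Set
  EarArc (inj₁ p) (inj₁ q) = ∃[ i ]
    ((p ≡ inject₁ i × q ≡ suc i × forward i ≡ true) ⊎
     (p ≡ suc i × q ≡ inject₁ i × forward i ≡ false))
  EarArc (inj₁ p) (inj₂ y) = y ≡ v₀ × (p ≡ zero ⊎ (p ≡ fromℕ m × out ≡ false))
  EarArc (inj₂ x) (inj₁ q) = x ≡ v₀ × (q ≡ zero ⊎ (q ≡ fromℕ m × out ≡ true))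
  EarArc (inj₂ x) (inj₂ y) = Arc F x y

  earArc? : ∀ s t → Dec (EarArc s t)
  earArc? (inj₁ p) (inj₁ q) = any? λ i →
    (p ≟ inject₁ i ×-dec q ≟ suc i ×-dec forward i Bool.≟ true) ⊎-dec
    (p ≟ suc i ×-dec q ≟ inject₁ i ×-dec forward i Bool.≟ false)
  earArc? (inj₁ p) (inj₂ y) =
    y ≟ v₀ ×-dec (p ≟ zero ⊎-dec (p ≟ fromℕ m ×-dec out Bool.≟ false))
  earArc? (inj₂ x) (inj₁ q) =
    x ≟ v₀ ×-dec (q ≟ zero ⊎-dec (q ≟ fromℕ m ×-dec out Bool.≟ true))
  earArc? (inj₂ x) (inj₂ y) = Bool.T? _

  inject₁≢suc : ∀ {n} (i : Fin n) → inject₁ i ≢ suc i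
  inject₁≢suc (suc i) eq = inject₁≢suc i (suc-injective eq)

  earArc-irrefl : ∀ s → ¬ EarArc s s
  earArc-irrefl (inj₁ p) (i , inj₁ (refl , eq , _)) = inject₁≢suc i eq
  earArc-irrefl (inj₁ p) (i , inj₂ (refl , eq , _)) = inject₁≢suc i (sym eq)
  earArc-irrefl (inj₂ x) a = Digraph.loopless F x a

  addEar : Digraph
  addEar = record
    { order    = suc m + order F
    ; arc      = λ x y → ⌊ earArc? (splitAt (suc m) x) (splitAt (suc m) y) ⌋
    ; loopless = λ x a → earArc-irrefl (splitAt (suc m) x) (toWitness a)
    }

open EarAddition public using (addEar)

data Octus : Digraph → Set where
  single     : Octus K₁
  ear        : ∀ {F} → Octus F → (v₀ : Vertex F)
               (m : ℕ) (forward : Fin m → Bool) (out : Bool) →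
               Octus (addEar F v₀ m forward out)
  subdigraph : ∀ {F H} → Octus F → H ⊑ F → Octus H

{-# OPTIONS --safe #-}

-- The lower bound comes from complete digraphs.  For the upper bound, an ear with k new
-- vertices is attached as follows.  Take a maximal k-colorable set A and embed the smaller
-- octus outside A, with root v = v₀; then A ∪ {v} is not k-colorable.  Let N be the set of
-- out-neighbors of v (reverse all arcs if the last arc of the ear enters v₀).  No coloring of
-- A keeps one color free of paths from N to the in-neighbors of v, and this obstruction
-- already lives on a strong part K of A, where a path may return to v through A \ K.
-- Hence one color class of K yields a directed cycle through v, which realizes the digon.
-- Without that class, every (k − 1)-coloring of K still uses all its colors on N, so a Gyárfás
-- path argument gives a path of any prescribed orientation that starts on the cycle, spends
-- one color per vertex by moving into ever smaller strong parts, and ends in N.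
-- Subdigraphs of octi are covered by embedding only a given list of vertices of the octus:
-- the remaining vertices of an ear, in order, lie again on an ear at the same root.

module Submission where

open import Defs

open import Data.Bool using (Bool; true; false)
import Data.Bool.Properties as Bool
open import Data.Empty using (⊥-elim)
open import Data.Fin as Fin using (Fin; zero; suc; punchIn; punchOut; splitAt; fromℕ; toℕ)
open import Data.Fin.Properties
  using (any?; all?; injective⇒≤; punchInᵢ≢i; punchIn-punchOut; punchOut-punchIn; punchOut-cong;
         splitAt-join; join-splitAt; toℕ-inject₁; toℕ-fromℕ; toℕ≤pred[n])
open import Data.Fin.Subset
  using (Subset; Nonempty; _∈_; _∉_; _⊆_; _⊂_; _⊃_; _-_; _─_; _∪_; ⊥; ⊤; ⁅_⁆)
open import Data.Fin.Subset.Induction using (⊂-wellFounded; ⊃-wellFounded)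
open import Data.Fin.Subset.Properties
  using (x∈p⇒p-x⊂p; x∈p∧x≢y⇒x∈p-y; p─q⊆p; x∈p∧x∉q⇒x∈p─q; x∈p∪q⁻; p⊆p∪q; q⊆p∪q;
         x∈⁅x⁆; x∈⁅y⁆⇒x≡y; ∉⊥; ∈⊤)
  renaming (_∈?_ to _∈ˢ?_)
open import Data.List
  using (List; []; _∷_; _++_; _∷ʳ_; map; reverse; length; filter; allFin; lookup)
open import Data.List.Properties
  using (unfold-reverse; reverse-++; ++-assoc; length-map; length-++; map-++; length-tabulate;
         map-∘; map-id-local)
import Data.List.Membership.DecPropositional as DecMem
open import Data.List.Membership.Propositional using () renaming (_∈_ to _∈ˡ_; _∉_ to _∉ˡ_)
open import Data.List.Membership.Propositional.Properties
  using (∈-map⁺; ∈-map⁻; ∈-++⁺ˡ; ∈-++⁺ʳ; ∈-++⁻; ∈-∃++; ∈-filter⁺; ∈-filter⁻; ∈-allFin; ∈-lookup)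
open import Data.List.Relation.Unary.All as All using (All; []; _∷_)
open import Data.List.Relation.Unary.All.Properties using (¬Any⇒All¬)
open import Data.List.Relation.Unary.AllPairs using (AllPairs; []; _∷_)
import Data.List.Relation.Unary.AllPairs.Properties as AllPairs
open import Data.List.Relation.Unary.Any using (here; there; index)
open import Data.List.Relation.Unary.Any.Properties using (reverse⁻; lookup-index)
open import Data.List.Relation.Unary.Linked using (Linked; []; [-]; _∷_)
import Data.List.Relation.Unary.Linked.Properties as Linked
open import Data.List.Relation.Unary.Unique.Propositional using (Unique)
import Data.List.Relation.Unary.Unique.Propositional.Properties as Unique
open import Data.Nat using (ℕ; zero; suc; _+_; _≤_; _<_; z≤n; s≤s; NonZero; >-nonZero⁻¹)
import Data.Nat.Properties as ℕ
open import Data.Product using (Σ; ∃; ∃-syntax; ∃₂; _×_; _,_; proj₁; proj₂)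
open import Data.Sum as Sum using (_⊎_; inj₁; inj₂; [_,_]′)
import Data.Sum.Properties as Sum
open import Data.Unit using (tt)
import Data.Vec as Vec
open Vec using ([]; _∷_; here; there)
import Data.Vec.Functional as Vector
import Data.Vec.Properties as Vec
open import Function using (_∘_; flip; id)
open import Induction.WellFounded using (Acc; acc)
open import Relation.Binary using (DecidableEquality)
open import Relation.Binary.PropositionalEquality
  using (_≡_; _≢_; _≗_; refl; sym; trans; cong; cong₂; subst; subst₂)
open import Relation.Nullary using (¬_; Dec; yes; no; does; ⌊_⌋; _×-dec_; _⊎-dec_; ¬?; contradiction)
open import Relation.Nullary.Decidable
  using (map′; decidable-stable; dec-true; toWitness; fromWitness)
open import Relation.Unary using (Decidable)

-- The obstacle is that three connections meet at v: the two paths for the digon and the last arc of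
-- the ear. The cycle formed by the digon's paths and the path along the ear may share just one
-- vertex. One color class keeps them apart: inside K the cycle uses color zero only, and once the
-- path has left the cycle by a link it stays in a set without that color. Strength of K supplies
-- links in both directions, so any orientation of the ear can be met. Strength has a price: a
-- strong part of A may lose the in-neighbors of v, so the cycle must be allowed to return outside
-- K, where no color is prescribed. The cycle vertex that becomes v₁ cannot be chosen beforehand; it
-- is where the link happens to meet the cycle.
--
-- The bound is the number of vertices because an ear with k new vertices consumes k colors: A can
-- be given k colors of its own, so the vertices outside A still need as many colors as the smaller
-- octus has vertices.
--
-- All properties are decidable on finite digraphs, so maximal sets and arguments by contradiction
-- are constructive.

module _ {n : ℕ} {P : Fin n → Set} (P? : Decidable P) where

  comprehension : Subset n
  comprehension = Vec.tabulate (does ∘ P?)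

  ∈-comprehension⁺ : ∀ {x} → P x → x ∈ comprehension
  ∈-comprehension⁺ {x} p = Vec.lookup⇒[]= x comprehension
    (trans (Vec.lookup∘tabulate (does ∘ P?) x) (dec-true (P? x) p))

  ∈-comprehension⁻ : ∀ {x} → x ∈ comprehension → P x
  ∈-comprehension⁻ {x} x∈ with P? x | Vec.lookup∘tabulate (does ∘ P?) x
  ... | yes p | _ = p
  ... | no _  | e with trans (sym e) (Vec.[]=⇒lookup x∈)
  ... | ()

-- A function is rebuilt from its value at zero and the rest, and the result agrees with it only
-- pointwise; `resp` stands in for function extensionality.
anyFunction? : ∀ {n m} {P : (Fin n → Fin m) → Set} →
               (∀ {f g} → f ≗ g → P f → P g) → Decidable P → Dec (∃ P)
anyFunction? {zero} {m} resp P? = map′ (empty ,_) (λ (f , p) → resp (λ ()) p) (P? empty)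
  where
  empty : Fin 0 → Fin m
  empty ()
anyFunction? {suc n} {P = P} resp P? =
  map′ (λ (a , f , p) → a Vector.∷ f , p)
       (λ (f , p) → f zero , f ∘ suc , resp (λ { zero → refl ; (suc i) → refl }) p)
       (any? λ a → anyFunction? {n} (λ f≗g → resp λ { zero → refl ; (suc i) → f≗g i })
                                     (λ f → P? (a Vector.∷ f)))

-- Walks, their cuts at a vertex, and decidability

module Walks {n : ℕ} (_⟶_ : Fin n → Fin n → Set) where

  -- Vertices may repeat, so walks restrict and concatenate freely; repetitions are removed only
  -- where a simple path is wanted. `P` holds at both ends as well.
  data Walk (P : Fin n → Set) : Fin n → Fin n → Set where
    here : ∀ {x} → P x → Walk P x x
    step : ∀ {x y z} → P x → x ⟶ y → Walk P y z → Walk P x z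

  module _ {P : Fin n → Set} where

    start : ∀ {x y} → Walk P x y → P x
    start (here p)     = p
    start (step p _ _) = p

    end : ∀ {x y} → Walk P x y → P y
    end (here p)     = p
    end (step _ _ w) = end w

    join : ∀ {x y y′ z} → Walk P x y → y ⟶ y′ → Walk P y′ z → Walk P x z
    join (here p)     a w = step p a w
    join (step p b v) a w = step p b (join v a w)

    append : ∀ {x y z} → Walk P x y → Walk P y z → Walk P x z
    append (here _)     w = w
    append (step p a v) w = step p a (append v w)

    mapWalk : ∀ {Q : Fin n → Set} → (∀ {x} → P x → Q x) → ∀ {x y} → Walk P x y → Walk Q x y
    mapWalk f (here p)     = here (f p)
    mapWalk f (step p a w) = step (f p) a (mapWalk f w)

    lastStep : ∀ {x y} → Walk P x y → x ≡ y ⊎ (∃[ z ] Walk P x z × z ⟶ y)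
    lastStep (here _) = inj₁ refl
    lastStep (step p a w) with lastStep w
    ... | inj₁ refl        = inj₂ (_ , here p , a)
    ... | inj₂ (z , v , b) = inj₂ (z , step p a v , b)

    visits : ∀ v {x y} → Walk P x y → Walk (λ z → P z × z ≢ v) x y ⊎ P v
    visits v (here {x} p) with x Fin.≟ v
    ... | yes refl = inj₂ p
    ... | no x≢v   = inj₁ (here (p , x≢v))
    visits v (step {x} p a w) with x Fin.≟ v | visits v w
    ... | yes refl | _        = inj₂ p
    ... | no _     | inj₂ q   = inj₂ q
    ... | no x≢v   | inj₁ w′  = inj₁ (step (p , x≢v) a w′)

    afterLastVisit : ∀ v {x y} → Walk P x y →
      Walk (λ z → P z × z ≢ v) x y ⊎
      (v ≡ y ⊎ ∃[ z ] v ⟶ z × Walk (λ z → P z × z ≢ v) z y)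
    afterLastVisit v {x} (here p) with x Fin.≟ v
    ... | yes refl = inj₂ (inj₁ refl)
    ... | no x≢v   = inj₁ (here (p , x≢v))
    afterLastVisit v {x} (step p a w) with afterLastVisit v w
    ... | inj₂ t = inj₂ t
    ... | inj₁ w′ with x Fin.≟ v
    ... | yes refl = inj₂ (inj₂ (_ , a , w′))
    ... | no x≢v   = inj₁ (step (p , x≢v) a w′)

    beforeFirstVisit : ∀ v {x y} → Walk P x y →
      Walk (λ z → P z × z ≢ v) x y ⊎
      (x ≡ v ⊎ ∃[ z ] Walk (λ z → P z × z ≢ v) x z × z ⟶ v)
    beforeFirstVisit v {x} w with x Fin.≟ v
    ... | yes x≡v = inj₂ (inj₁ x≡v)
    beforeFirstVisit v (here p) | no x≢v = inj₁ (here (p , x≢v))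
    beforeFirstVisit v (step p a w) | no x≢v with beforeFirstVisit v w
    ... | inj₁ w′                 = inj₁ (step (p , x≢v) a w′)
    ... | inj₂ (inj₁ refl)        = inj₂ (inj₂ (_ , here (p , x≢v) , a))
    ... | inj₂ (inj₂ (z , v , b)) = inj₂ (inj₂ (z , step (p , x≢v) a v , b))

  module _ (_⟶?_ : ∀ x y → Dec (x ⟶ y)) where

    -- A walk from `x` to another vertex can be restarted after its last visit to `x`; the rest
    -- avoids `x`, so the search continues in the smaller set `K - x`.
    walkWithin? : ∀ (K : Subset n) → Acc _⊂_ K → ∀ x y → Dec (Walk (_∈ K) x y)
    walkWithin? K (acc rec) x y with x ∈ˢ? K
    ... | no x∉K = no (x∉K ∘ start)
    ... | yes x∈K with x Fin.≟ y
    ... | yes refl = yes (here x∈K)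
    ... | no x≢y = map′ build split
            (any? λ z → (x ⟶? z) ×-dec walkWithin? (K - x) (rec (x∈p⇒p-x⊂p x∈K)) z y)
      where
      build : (∃[ z ] x ⟶ z × Walk (_∈ (K - x)) z y) → Walk (_∈ K) x y
      build (z , a , w) = step x∈K a (mapWalk (p─q⊆p K ⁅ x ⁆) w)
      split : Walk (_∈ K) x y → ∃[ z ] x ⟶ z × Walk (_∈ (K - x)) z y
      split w with afterLastVisit x w
      ... | inj₁ w′ = contradiction refl (proj₂ (start w′))
      ... | inj₂ (inj₁ x≡y) = contradiction x≡y x≢y
      ... | inj₂ (inj₂ (z , a , w′)) =
        z , a , mapWalk (λ (p , q) → x∈p∧x≢y⇒x∈p-y p q) w′

    walk? : ∀ {P} → Decidable P → ∀ x y → Dec (Walk P x y)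
    walk? P? x y = map′ (mapWalk (∈-comprehension⁻ P?)) (mapWalk (∈-comprehension⁺ P?))
      (walkWithin? (comprehension P?) (⊂-wellFounded _) x y)

-- Simple paths, and links between two sets

module Links {n : ℕ} (_⟶_ : Fin n → Fin n → Set) where
  open Walks _⟶_

  data IsPath : Fin n → List (Fin n) → Fin n → Set where
    [_] : ∀ x → IsPath x (x ∷ []) x
    _∷_ : ∀ {x y l z} → x ⟶ y → IsPath y l z → IsPath x (x ∷ l) z

  record SimplePath (P : Fin n → Set) (x y : Fin n) : Set where
    constructor simple
    field
      {route}  : List (Fin n)
      isPath   : IsPath x route y
      inside   : All P route
      distinct : Unique route

  suffix : ∀ {P x y z l} → IsPath y l z → All P l → Unique l → x ∈ˡ l → SimplePath P x z
  suffix p@([ _ ])   ps u (here refl) = simple p ps u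
  suffix p@(_ ∷ _)   ps u (here refl) = simple p ps u
  suffix (_ ∷ p) (_ ∷ ps) (_ ∷ u) (there x∈l) = suffix p ps u x∈l

  simplify : ∀ {P x y} → Walk P x y → SimplePath P x y
  simplify (here p) = simple [ _ ] (p ∷ []) ([] ∷ [])
  simplify {x = x} (step p a w) with simplify w
  ... | simple {l} q ps u with DecMem._∈?_ Fin._≟_ x l
  ... | yes x∈l = suffix q ps u x∈l
  ... | no x∉l  = simple (a ∷ q) (p ∷ ps) (¬Any⇒All¬ _ x∉l ∷ u)

  linked : ∀ {x y l z w} → x ⟶ y → IsPath y l z → z ⟶ w → Linked _⟶_ (x ∷ l ∷ʳ w)
  linked a [ _ ]   b = a ∷ b ∷ [-]
  linked a (c ∷ p) b = a ∷ linked c p b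

  -- The ends are not prescribed, only the sets they lie in. The interior misses `S` and `T`, so
  -- distinctness has to be asked only within the interior.
  record Link (P S T : Fin n → Set) : Set where
    field
      {source target} : Fin n
      {interior}      : List (Fin n)
      source∈         : P source × S source
      target∈         : P target × T target
      chain           : Linked _⟶_ (source ∷ interior ∷ʳ target)
      inside          : All (λ z → P z × ¬ S z × ¬ T z) interior
      distinct        : Unique interior

  module _ {P S T : Fin n → Set} (S? : Decidable S) (T? : Decidable T)
           (disjoint : ∀ {z} → S z → ¬ T z) where

    private
      Between : Fin n → Set
      Between z = P z × ¬ S z × ¬ T z

      Tail : Fin n → Set
      Tail x = (P x × T x) ⊎ (∃₂ λ y z → Walk Between x y × y ⟶ z × P z × T z)

      Found : Set
      Found = ∃₂ λ x y → P x × S x × x ⟶ y × Tail y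

      -- Stops at the first vertex in `T` and goes back to the last vertex in `S` before it; what
      -- lies between misses both sets.
      search : ∀ {x z} → Walk P x z → T z → Found ⊎ Tail x
      search (here p) t = inj₂ (inj₁ (p , t))
      search {x} (step p a w) t with T? x
      ... | yes t′ = inj₂ (inj₁ (p , t′))
      ... | no ¬t with search w t | S? x
      ... | inj₁ f | _     = inj₁ f
      ... | inj₂ e | yes s = inj₁ (_ , _ , p , s , a , e)
      ... | inj₂ (inj₁ (q , t′)) | no ¬s = inj₂ (inj₂ (_ , _ , here (p , ¬s , ¬t) , a , q , t′))
      ... | inj₂ (inj₂ (_ , _ , v , b , r)) | no ¬s =
        inj₂ (inj₂ (_ , _ , step (p , ¬s , ¬t) a v , b , r))

      found : Found → Link P S T
      found (_ , _ , p , s , a , inj₁ (q , t)) = record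
        { source∈ = p , s ; target∈ = q , t ; interior = [] ; chain = a ∷ [-]
        ; inside = [] ; distinct = [] }
      found (_ , _ , p , s , a , inj₂ (_ , _ , w , b , q , t)) with simplify w
      ... | simple r ps u = record
        { source∈ = p , s ; target∈ = q , t ; chain = linked a r b ; inside = ps ; distinct = u }

    link : ∀ {x z} → Walk P x z → S x → T z → Link P S T
    link w s t with search w t
    ... | inj₁ f = found f
    ... | inj₂ (inj₁ (_ , t′)) = contradiction t′ (disjoint s)
    ... | inj₂ (inj₂ (_ , _ , v , _)) = contradiction s (proj₁ (proj₂ (start v)))

-- Acyclic colorings, strong parts, and removal of a color class

module Colorings {n : ℕ} {_⟶_ : Fin n → Fin n → Set} (_⟶?_ : ∀ x y → Dec (x ⟶ y)) where
  open Walks _⟶_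

  Class : ∀ {m} → (Fin n → Fin m) → Subset n → Fin m → Fin n → Set
  Class c K j z = z ∈ K × c z ≡ j

  class? : ∀ {m} (c : Fin n → Fin m) K j → Decidable (Class c K j)
  class? c K j z = (z ∈ˢ? K) ×-dec (c z Fin.≟ j)

  -- Closed walks stand in for directed cycles, so no distinctness has to be carried along when
  -- colorings are restricted or combined. Only the values of `c` on `K` count.
  Proper : ∀ {m} → (Fin n → Fin m) → Subset n → Set
  Proper c K = ∀ j x y → Walk (Class c K j) x y → ¬ (y ⟶ x)

  proper? : ∀ {m} (c : Fin n → Fin m) K → Dec (Proper c K)
  proper? c K = all? λ j → all? λ x → all? λ y →
    map′ (λ f w a → f (w , a)) (λ f (w , a) → f w a)
         (¬? (walk? _⟶?_ (class? c K j) x y ×-dec (y ⟶? x)))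

  proper-resp : ∀ {m} {c d : Fin n → Fin m} {K} → c ≗ d → Proper c K → Proper d K
  proper-resp c≗d p j x y w = p j x y (mapWalk (λ (z∈ , e) → z∈ , trans (c≗d _) e) w)

  proper-⊆ : ∀ {m} {c : Fin n → Fin m} {K L} → L ⊆ K → Proper c K → Proper c L
  proper-⊆ L⊆K p j x y w = p j x y (mapWalk (λ (z∈ , e) → L⊆K z∈ , e) w)

  Strong : Subset n → Set
  Strong K = ∀ x y → x ∈ K → y ∈ K → Walk (_∈ K) x y

  module Splitting (H : Subset n) {N T : Fin n → Set}
                   (N? : Decidable N) (T? : Decidable T) where

    -- Passing to part of K only adds exits; this is what makes colorings of two parts
    -- compatible in glue-avoiding.
    Exit : Subset n → Fin n → Set
    Exit K u = T u ⊎ (∃[ v ] u ⟶ v × ∃[ t ] Walk (λ z → z ∈ H × z ∉ K) v t × T t)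

    exit? : ∀ K → Decidable (Exit K)
    exit? K u = T? u ⊎-dec any? λ v → (u ⟶? v) ×-dec any? λ t →
      walk? _⟶?_ (λ z → (z ∈ˢ? H) ×-dec ¬? (z ∈ˢ? K)) v t ×-dec T? t

    -- Colors can be permuted, so it is enough to look at color zero.
    Avoiding : ∀ {m} → Subset n → (Fin n → Fin (suc m)) → Set
    Avoiding K c = Proper c K × (∀ a b → N a → Exit K b → ¬ Walk (Class c K zero) a b)

    avoiding? : ∀ {m} K → Decidable (Avoiding {m} K)
    avoiding? K c = proper? c K ×-dec all? λ a → all? λ b →
      map′ (λ f na eb w → f (na , eb , w)) (λ f (na , eb , w) → f na eb w)
        (¬? (N? a ×-dec exit? K b ×-dec walk? _⟶?_ (class? c K zero) a b))

    Unavoidable : ℕ → Subset n → Set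
    Unavoidable m K = ¬ ∃ (Avoiding {m} K)

    avoidable? : ∀ m K → Dec (∃ (Avoiding {m} K))
    avoidable? m K = anyFunction?
      (λ c≗d (p , q) → proper-resp c≗d p ,
        λ a b na eb w → q a b na eb (mapWalk (λ (z∈ , e) → z∈ , trans (c≗d _) e) w))
      (avoiding? K)

    module _ {m : ℕ} {K U L : Subset n} (K⊆H : K ⊆ H) (U⊆K : U ⊆ K) (L⊆K : L ⊆ K)
             (disjoint : ∀ {z} → z ∈ U → z ∉ L)
             (cover : ∀ {z} → z ∈ K → z ∉ U → z ∈ L)
             (closed : ∀ {x y} → x ∈ U → y ∈ K → x ⟶ y → y ∈ U)
             (c d : Fin n → Fin (suc m)) where

      private
        choose : ∀ {z} → Dec (z ∈ U) → Fin (suc m)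
        choose {z} (yes _) = c z
        choose {z} (no _)  = d z

        e : Fin n → Fin (suc m)
        e z = choose (z ∈ˢ? U)

        toU : ∀ {j z} → z ∈ U → Class e K j z → Class c U j z
        toU {z = z} z∈U (_ , eq) with z ∈ˢ? U
        ... | yes _  = z∈U , eq
        ... | no z∉U = contradiction z∈U z∉U

        toL : ∀ {j z} → z ∈ L → Class e K j z → Class d L j z
        toL {z = z} z∈L (_ , eq) with z ∈ˢ? U
        ... | yes z∈U = contradiction z∈L (disjoint z∈U)
        ... | no _    = z∈L , eq

        walkU : ∀ {j x y} → x ∈ U → Walk (Class e K j) x y → Walk (Class c U j) x y
        walkU x∈U (here p)     = here (toU x∈U p)
        walkU x∈U (step p a w) = step (toU x∈U p) a (walkU (closed x∈U (proj₁ (start w)) a) w)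

        walkL : ∀ {j x y} → x ∈ L → Walk (Class e K j) x y →
                (y ∈ L × Walk (Class d L j) x y) ⊎
                (∃₂ λ l u → Walk (Class d L j) x l × l ⟶ u × Walk (Class c U j) u y)
        walkL x∈L (here p) = inj₁ (x∈L , here (toL x∈L p))
        walkL x∈L (step {y = y} p a w) with y ∈ˢ? U
        ... | yes y∈U = inj₂ (_ , _ , here (toL x∈L p) , a , walkU y∈U w)
        ... | no y∉U with walkL (cover (proj₁ (start w)) y∉U) w
        ... | inj₁ (z∈L , v) = inj₁ (z∈L , step (toL x∈L p) a v)
        ... | inj₂ (_ , _ , v , b , r) = inj₂ (_ , _ , step (toL x∈L p) a v , b , r)

      -- Arcs between the two parts lead only from `L` to `U`, so a monochromatic closed walk stays
      -- in one part. A walk of color zero from `N` to an exit changes parts at most once. If it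
      -- does, its last vertex in `L` is an exit of `L`, because what follows stays in `H` outside
      -- `L` until it reaches `T`; hence `d` excludes it.
      glue-avoiding : Avoiding U c → Avoiding L d → Avoiding K e
      glue-avoiding (pc , ac) (pd , ad) = proper , avoids
        where
        proper : Proper e K
        proper j x y w a with x ∈ˢ? U
        ... | yes x∈U = pc j x y (walkU x∈U w) a
        ... | no x∉U with walkL (cover (proj₁ (start w)) x∉U) w
        ... | inj₁ (_ , v) = pd j x y v a
        ... | inj₂ (_ , _ , _ , _ , v) = x∉U (closed (proj₁ (end v)) (proj₁ (start w)) a)

        exitU : ∀ {b} → Exit K b → Exit U b
        exitU (inj₁ t) = inj₁ t
        exitU (inj₂ (v , a , t , w , τ)) =
          inj₂ (v , a , t , mapWalk (λ (h , z∉K) → h , z∉K ∘ U⊆K) w , τ)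

        exitL : ∀ {b} → Exit K b → Exit L b
        exitL (inj₁ t) = inj₁ t
        exitL (inj₂ (v , a , t , w , τ)) =
          inj₂ (v , a , t , mapWalk (λ (h , z∉K) → h , z∉K ∘ L⊆K) w , τ)

        outsideL : ∀ {j x y} → Walk (Class c U j) x y → Walk (λ z → z ∈ H × z ∉ L) x y
        outsideL = mapWalk λ (z∈U , _) → K⊆H (U⊆K z∈U) , disjoint z∈U

        avoids : ∀ a b → N a → Exit K b → ¬ Walk (Class e K zero) a b
        avoids a b na eb w with a ∈ˢ? U
        ... | yes a∈U = ac a b na (exitU eb) (walkU a∈U w)
        ... | no a∉U with walkL (cover (proj₁ (start w)) a∉U) w
        ... | inj₁ (_ , v) = ad a b na (exitL eb) v
        avoids a b na (inj₁ t) w | no _ | inj₂ (l , u , v , f , r) =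
          ad a l na (inj₂ (u , f , b , outsideL r , t)) v
        avoids a b na (inj₂ (_ , g , t , s , τ)) w | no _ | inj₂ (l , u , v , f , r) =
          ad a l na (inj₂ (u , f , t , join (outsideL r) g
            (mapWalk (λ (h , z∉K) → h , z∉K ∘ L⊆K) s) , τ)) v

    -- If `y` cannot be reached from `x` in `K`, the vertices reached from `x` and the remaining
    -- ones split `K` as gluing requires. Avoiding colorings of both parts would combine, so one of
    -- these smaller parts is again unavoidable.
    strongPart : ∀ {m} K → Acc _⊂_ K → K ⊆ H → Unavoidable m K →
                 ∃[ L ] L ⊆ K × Strong L × Unavoidable m L
    strongPart {m} K (acc rec) K⊆H un with any? (λ x → any? (λ y →
      (x ∈ˢ? K) ×-dec (y ∈ˢ? K) ×-dec ¬? (walk? _⟶?_ (_∈ˢ? K) x y)))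
    ... | no none = K , id , (λ x y x∈ y∈ → decidable-stable (walk? _⟶?_ (_∈ˢ? K) x y)
                                (λ ¬w → none (x , y , x∈ , y∈ , ¬w))) , un
    ... | yes (x , y , x∈K , y∈K , ¬w) = continue (avoidable? m U) (avoidable? m L)
      where
      reached? : Decidable (Walk (_∈ K) x)
      reached? = walk? _⟶?_ (_∈ˢ? K) x
      unreached? : Decidable (λ z → z ∈ K × ¬ Walk (_∈ K) x z)
      unreached? z = (z ∈ˢ? K) ×-dec ¬? (reached? z)
      U = comprehension reached?
      L = comprehension unreached?
      U⊆K : U ⊆ K
      U⊆K z∈U = end (∈-comprehension⁻ reached? z∈U)
      L⊆K : L ⊆ K
      L⊆K z∈L = proj₁ (∈-comprehension⁻ unreached? z∈L)
      disjoint : ∀ {z} → z ∈ U → z ∉ L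
      disjoint z∈U z∈L = proj₂ (∈-comprehension⁻ unreached? z∈L) (∈-comprehension⁻ reached? z∈U)
      cover : ∀ {z} → z ∈ K → z ∉ U → z ∈ L
      cover z∈K z∉U = ∈-comprehension⁺ unreached? (z∈K , z∉U ∘ ∈-comprehension⁺ reached?)
      closed : ∀ {u v} → u ∈ U → v ∈ K → u ⟶ v → v ∈ U
      closed u∈U v∈K a = ∈-comprehension⁺ reached? (join (∈-comprehension⁻ reached? u∈U) a (here v∈K))
      y∈L : y ∈ L
      y∈L = ∈-comprehension⁺ unreached? (y∈K , ¬w)
      x∈U : x ∈ U
      x∈U = ∈-comprehension⁺ reached? (here x∈K)
      continue : Dec (∃ (Avoiding {m} U)) → Dec (∃ (Avoiding {m} L)) →
                 ∃[ L ] L ⊆ K × Strong L × Unavoidable m L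
      continue (no unU) _ with strongPart U (rec (U⊆K , y , y∈K , λ y∈U → disjoint y∈U y∈L)) (K⊆H ∘ U⊆K) unU
      ... | J , J⊆U , s , u = J , U⊆K ∘ J⊆U , s , u
      continue (yes _) (no unL) with strongPart L (rec (L⊆K , x , x∈K , disjoint x∈U)) (K⊆H ∘ L⊆K) unL
      ... | J , J⊆L , s , u = J , L⊆K ∘ J⊆L , s , u
      continue (yes (c , ac)) (yes (d , ad)) =
        ⊥-elim (un (_ , glue-avoiding K⊆H U⊆K L⊆K disjoint cover closed c d ac ad))

  module _ {N : Fin n → Set} (N? : Decidable N) where

    -- Again by symmetry: every proper coloring of K with suc m colors uses each color on N.
    Saturated : ℕ → Subset n → Set
    Saturated m K = ¬ ∃ λ (c : Fin n → Fin (suc m)) → Proper c K × (∀ a → N a → ¬ Class c K zero a)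

    -- The splitting argument with `T` always true: every vertex is an exit and one-vertex walks
    -- count, so avoiding means that color zero does not occur on `N`.
    strongSaturatedPart : ∀ {m} K → Saturated m K → ∃[ L ] L ⊆ K × Strong L × Saturated m L
    strongSaturatedPart {m} K sat with strongPart K (⊂-wellFounded K) id un
      where
      open Splitting K N? (λ _ → yes tt)
      un : Unavoidable m K
      un (c , p , av) = sat (c , p , λ a na z∈ → av a a na (inj₁ tt) (here z∈))
    ... | L , L⊆K , s , u = L , L⊆K , s , λ (c , p , av) → u (c , p , λ a b na _ w → av a na (start w))

    module _ {m : ℕ} (K : Subset n) (c : Fin n → Fin (suc (suc m))) (i : Fin (suc (suc m)))
             (proper : Proper c K) (saturated : Saturated (suc m) K) where

      private
        rest? : Decidable (λ z → z ∈ K × c z ≢ i)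
        rest? z = (z ∈ˢ? K) ×-dec ¬? (c z Fin.≟ i)

        B : Subset n
        B = comprehension rest?

        saturatedB : Saturated m B
        saturatedB (d , pd , avd) = saturated (e , pe , ave)
          where
          choose : ∀ {z} → Dec (z ∈ B) → Fin (suc (suc m))
          -- Color one is freed for the removed class, so color zero, which `d` keeps off `N`, is
          -- not reused.
          choose {z} (yes _) = punchIn (suc zero) (d z)
          choose (no _)      = suc zero
          e : Fin n → Fin (suc (suc m))
          e z = choose (z ∈ˢ? B)
          toC : ∀ {z} → Class e K (suc zero) z → Class c K i z
          toC {z} (z∈K , eq) with z ∈ˢ? B
          ... | yes _  = contradiction eq (punchInᵢ≢i (suc zero) (d z))
          ... | no z∉B = z∈K , decidable-stable (c z Fin.≟ i) λ ne → z∉B (∈-comprehension⁺ rest? (z∈K , ne))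
          toD : ∀ {j z} (ne : suc zero ≢ j) → Class e K j z → Class d B (punchOut ne) z
          toD {j} {z} ne (z∈K , eq) with z ∈ˢ? B
          ... | yes z∈B = z∈B , trans (sym (punchOut-punchIn (suc zero))) (punchOut-cong (suc zero) eq)
          ... | no _    = contradiction eq ne
          pe : Proper e K
          pe j x y w a with suc zero Fin.≟ j
          ... | yes refl = proper i x y (mapWalk toC w) a
          ... | no ne    = pd (punchOut ne) x y (mapWalk (toD ne) w) a
          ave : ∀ a → N a → ¬ Class e K zero a
          ave a na cl = avd a na (toD (λ ()) cl)

      -- A coloring of B without color zero on N extends to K, with B's complement as a new class.
      removeClass : ∃[ L ] L ⊆ K × (∀ {z} → z ∈ L → c z ≢ i) × Strong L × Saturated m L ×
                    (∃ λ (d : Fin n → Fin (suc m)) → Proper d L) × ∃ (_∈ L)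
      removeClass with strongSaturatedPart B saturatedB
      ... | L , L⊆B , strong , satL = L , proj₁ ∘ rest , proj₂ ∘ rest , strong , satL , (d , pd) ,
              -- An empty set is not saturated, since nothing in it has color zero.
              decidable-stable (any? (_∈ˢ? L)) λ empty → satL (d , pd , λ a _ (a∈ , _) → empty (a , a∈))
        where
        rest : ∀ {z} → z ∈ L → z ∈ K × c z ≢ i
        rest z∈L = ∈-comprehension⁻ rest? (L⊆B z∈L)
        choose : ∀ {z} → Dec (i ≡ c z) → Fin (suc m)
        choose (yes _) = zero
        choose (no ne) = punchOut ne
        d : Fin n → Fin (suc m)
        d z = choose (i Fin.≟ c z)
        back : ∀ {j z} → Class d L j z → Class c K (punchIn i j) z
        back {j} {z} (z∈ , eq) with i Fin.≟ c z
        ... | yes e = contradiction (sym e) (proj₂ (rest z∈))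
        ... | no ne = proj₁ (rest z∈) , trans (sym (punchIn-punchOut ne)) (cong (punchIn i) eq)
        pd : Proper d L
        pd j x y w = proper (punchIn i j) x y (mapWalk back w)

-- Embedded subdivisions of the digraph induced on a list

On : {X : Set} → (X → X → Set) → List X → X → X → Set
On R xs x y = x ∈ˡ xs × y ∈ˡ xs × R x y

-- A subdivision of the digraph that R induces on the list xs, inside W;
-- `branch` and `inner` are junk outside xs and off the arcs.
record Embedding {X : Set} {n : ℕ} (_⟶_ : Fin n → Fin n → Set)
                 (R : X → X → Set) (W : Fin n → Set) (xs : List X) : Set where
  field
    branch           : X → Fin n
    inner            : X → X → List (Fin n)
    branch∈          : ∀ {x} → x ∈ˡ xs → W (branch x)
    branch-injective : ∀ {x y} → x ∈ˡ xs → y ∈ˡ xs → branch x ≡ branch y → x ≡ y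
    linked           : ∀ {x y} → On R xs x y → Linked _⟶_ (branch x ∷ inner x y ∷ʳ branch y)
    distinct         : ∀ {x y} → On R xs x y → Unique (inner x y)
    inner∈           : ∀ {x y z} → On R xs x y → z ∈ˡ inner x y → W z
    inner-new        : ∀ {x y z w} → On R xs x y → z ∈ˡ inner x y → w ∈ˡ xs → z ≢ branch w
    inner-disjoint   : ∀ {x y x′ y′ z} → On R xs x y → On R xs x′ y′ →
                       z ∈ˡ inner x y → z ∈ˡ inner x′ y′ → x ≡ x′ × y ≡ y′

module _ {n : ℕ} {_⟶_ : Fin n → Fin n → Set} where

  -- Serves for passing to a subdigraph, for renaming vertices, and, with `f` the identity, for
  -- dropping or reordering entries of the list.
  pullback : ∀ {X Y R S W} (f : X → Y) {xs : List X} {ys : List Y} → (∀ {x} → x ∈ˡ xs → f x ∈ˡ ys) →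
             (∀ {x y} → x ∈ˡ xs → y ∈ˡ xs → f x ≡ f y → x ≡ y) →
             (∀ {x y} → On R xs x y → S (f x) (f y)) →
             Embedding _⟶_ S W ys → Embedding _⟶_ R W xs
  pullback {R = R} {S = S} f {xs} {ys} f∈ inj pres e = record
    { branch = branch ∘ f ; inner = λ x y → inner (f x) (f y)
    ; branch∈ = branch∈ ∘ f∈
    ; branch-injective = λ x∈ y∈ eq → inj x∈ y∈ (branch-injective (f∈ x∈) (f∈ y∈) eq)
    ; linked = linked ∘ on ; distinct = distinct ∘ on ; inner∈ = inner∈ ∘ on
    ; inner-new = λ o z∈ w∈ → inner-new (on o) z∈ (f∈ w∈)
    ; inner-disjoint = λ { o@(x∈ , y∈ , _) o′@(x∈′ , y∈′ , _) z∈ z∈′ →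
        let p , q = inner-disjoint (on o) (on o′) z∈ z∈′ in inj x∈ x∈′ p , inj y∈ y∈′ q } }
    where
    open Embedding e
    on : ∀ {x y} → On R xs x y → On S ys (f x) (f y)
    on o@(x∈ , y∈ , _) = f∈ x∈ , f∈ y∈ , pres o

  snoc-linked : ∀ {x y} (l : List (Fin n)) → Linked _⟶_ (l ∷ʳ x) → x ⟶ y → Linked _⟶_ (l ∷ʳ x ∷ʳ y)
  snoc-linked []          [-]      b = b ∷ [-]
  snoc-linked (_ ∷ [])    (a ∷ as) b = a ∷ snoc-linked [] as b
  snoc-linked (_ ∷ z ∷ l) (a ∷ as) b = a ∷ snoc-linked (z ∷ l) as b

reverse-unique : ∀ {A : Set} (l : List A) → Unique l → Unique (reverse l)
reverse-unique [] [] = []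
reverse-unique (x ∷ l) (x∉ ∷ u) rewrite unfold-reverse x l =
  Unique.++⁺ (reverse-unique l u) ([] ∷ []) λ { (z∈ , here refl) → All.lookup x∉ (reverse⁻ z∈) refl }

module _ {n : ℕ} {_⟶_ : Fin n → Fin n → Set} where

  reverse-linked : (l : List (Fin n)) → Linked _⟶_ l → Linked (flip _⟶_) (reverse l)
  reverse-linked []          []       = []
  reverse-linked (_ ∷ [])    [-]      = [-]
  reverse-linked (x ∷ y ∷ l) (a ∷ as) with reverse-linked (y ∷ l) as
  ... | r rewrite unfold-reverse x (y ∷ l) | unfold-reverse y l = snoc-linked (reverse l) r a

  reverse-link : ∀ {x y} (l : List (Fin n)) → Linked _⟶_ (x ∷ l ∷ʳ y) →
                 Linked (flip _⟶_) (y ∷ reverse l ∷ʳ x)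
  reverse-link {x} {y} l as = subst (Linked (flip _⟶_))
    (trans (unfold-reverse x (l ∷ʳ y)) (cong (_∷ʳ x) (reverse-++ l (y ∷ []))))
    (reverse-linked _ as)

  opposite : ∀ {X R W} {xs : List X} → Embedding _⟶_ R W xs → Embedding (flip _⟶_) (flip R) W xs
  opposite {R = R} {xs = xs} e = record
    { branch = branch ; inner = λ x y → reverse (inner y x)
    ; branch∈ = branch∈ ; branch-injective = branch-injective
    ; linked = λ {x} {y} o → reverse-link (inner y x) (linked (op o))
    ; distinct = λ {x} {y} o → reverse-unique (inner y x) (distinct (op o))
    ; inner∈ = λ o z∈ → inner∈ (op o) (reverse⁻ z∈)
    ; inner-new = λ o z∈ → inner-new (op o) (reverse⁻ z∈)
    ; inner-disjoint = λ o o′ z∈ z∈′ →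
        let p , q = inner-disjoint (op o) (op o′) (reverse⁻ z∈) (reverse⁻ z∈′) in q , p }
    where
    open Embedding e
    op : ∀ {x y} → On (flip R) xs x y → On R xs y x
    op (x∈ , y∈ , r) = y∈ , x∈ , r

lastOf : {X : Set} → X → List X → X
lastOf u []       = u
lastOf _ (u ∷ us) = lastOf u us

lastOf∈ : ∀ {X : Set} (u : X) us → lastOf u us ∈ˡ u ∷ us
lastOf∈ u []       = here refl
lastOf∈ _ (u ∷ us) = there (lastOf∈ u us)

-- Gluing embeddings and adding a root

module Gluing {n : ℕ} {_⟶_ : Fin n → Fin n → Set} {X : Set} (_≟_ : DecidableEquality X)
              {R : X → X → Set} where

  open DecMem _≟_ using (_∈?_)

  singleton : ∀ {W : Fin n → Set} x v → ¬ R x x → W v → Embedding _⟶_ R W (x ∷ [])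
  singleton x v irr wv = record
    { branch = λ _ → v ; inner = λ _ _ → [] ; branch∈ = λ _ → wv
    ; branch-injective = λ { (here refl) (here refl) _ → refl }
    ; linked = λ { (here refl , here refl , r) → contradiction r irr }
    ; distinct = λ _ → [] ; inner∈ = λ _ () ; inner-new = λ _ () ; inner-disjoint = λ _ _ () }

  module _ {W : Fin n → Set} {u u′ : X} {p q : Fin n} {l : List (Fin n)}
           (u≢u′ : u ≢ u′) (irr : ¬ R u u) (irr′ : ¬ R u′ u′) (asym : R u u′ → ¬ R u′ u)
           (forth : R u u′ → Linked _⟶_ (p ∷ l ∷ʳ q)) (back : R u′ u → Linked _⟶_ (q ∷ l ∷ʳ p))
           (p≢q : p ≢ q) (Wp : W p) (Wq : W q)
           (inside : All (λ z → W z × z ≢ p × z ≢ q) l) (unique : Unique l) where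

    private
      choose : ∀ {x} → Dec (x ≡ u) → Fin n
      choose (yes _) = p
      choose (no _)  = q

      branch : X → Fin n
      branch x = choose (x ≟ u)

      data Branch : X → Fin n → Set where
        first  : Branch u p
        second : Branch u′ q

      view : ∀ {x} → x ∈ˡ u ∷ u′ ∷ [] → Branch x (branch x)
      view {x} x∈ with x ≟ u
      view x∈ | yes refl = first
      view (here x≡u) | no x≢u = contradiction x≡u x≢u
      view (there (here refl)) | no _ = second

      injective : ∀ {x y a b} → Branch x a → Branch y b → a ≡ b → x ≡ y
      injective first first _ = refl
      injective first second e = contradiction e p≢q
      injective second first e = contradiction (sym e) p≢q
      injective second second _ = refl

      linked : ∀ {x y a b} → Branch x a → Branch y b → R x y → Linked _⟶_ (a ∷ l ∷ʳ b)
      linked first first r = contradiction r irr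
      linked first second r = forth r
      linked second first r = back r
      linked second second r = contradiction r irr′

      W-branch : ∀ {x a} → Branch x a → W a
      W-branch first = Wp
      W-branch second = Wq

      new : ∀ {x a z} → Branch x a → z ∈ˡ l → z ≢ a
      new first  z∈ = proj₁ (proj₂ (All.lookup inside z∈))
      new second z∈ = proj₂ (proj₂ (All.lookup inside z∈))

      same : ∀ {x y x′ y′} → On R (u ∷ u′ ∷ []) x y → On R (u ∷ u′ ∷ []) x′ y′ → x ≡ x′ × y ≡ y′
      same (here refl , here refl , r) _ = contradiction r irr
      same (there (here refl) , there (here refl) , r) _ = contradiction r irr′
      same _ (here refl , here refl , r) = contradiction r irr
      same _ (there (here refl) , there (here refl) , r) = contradiction r irr′
      same (here refl , there (here refl) , r) (here refl , there (here refl) , s) = refl , refl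
      same (here refl , there (here refl) , r) (there (here refl) , here refl , s) = contradiction s (asym r)
      same (there (here refl) , here refl , r) (here refl , there (here refl) , s) = contradiction r (asym s)
      same (there (here refl) , here refl , r) (there (here refl) , here refl , s) = refl , refl

    -- At most one of the two arcs between `u` and `u′` exists, so `inner` may be constant: `l`
    -- leads from `p` to `q` or from `q` to `p`, as that arc requires.
    pair : Σ (Embedding _⟶_ R W (u ∷ u′ ∷ [])) λ e →
           Embedding.branch e u ≡ p × Embedding.branch e u′ ≡ q
    pair = record
      { branch = branch ; inner = λ _ _ → l
      ; branch∈ = W-branch ∘ view
      ; branch-injective = λ x∈ y∈ → injective (view x∈) (view y∈)
      ; linked = λ (x∈ , y∈ , r) → linked (view x∈) (view y∈) r
      ; distinct = λ _ → unique
      ; inner∈ = λ _ z∈ → proj₁ (All.lookup inside z∈)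
      ; inner-new = λ _ z∈ w∈ → new (view w∈) z∈
      ; inner-disjoint = λ o o′ _ _ → same o o′
      } , at-u , at-u′
      where
      at-u : branch u ≡ p
      at-u with u ≟ u
      ... | yes _ = refl
      ... | no ne = contradiction refl ne
      at-u′ : branch u′ ≡ q
      at-u′ with u′ ≟ u
      ... | yes e = contradiction (sym e) u≢u′
      ... | no _  = refl

  module _ {W₁ W₂ W : Fin n → Set} {xs ys zs : List X} {x₀ : X}
           (e₁ : Embedding _⟶_ R W₁ xs) (e₂ : Embedding _⟶_ R W₂ ys)
           (x₀∈xs : x₀ ∈ˡ xs) (x₀∈ys : x₀ ∈ˡ ys)
           (common : ∀ {z} → z ∈ˡ xs → z ∈ˡ ys → z ≡ x₀)
           (cover : ∀ {z} → z ∈ˡ zs → z ∈ˡ xs ⊎ z ∈ˡ ys)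
           (crossing : ∀ {x y} → x ∈ˡ xs → y ∈ˡ ys → R x y ⊎ R y x → x ≡ x₀ ⊎ y ≡ x₀) where
    private
      module E₁ = Embedding e₁
      module E₂ = Embedding e₂

    module _ (agree : E₁.branch x₀ ≡ E₂.branch x₀)
             (meet : ∀ {z} → W₁ z → W₂ z → z ≡ E₂.branch x₀)
             (W₁⊆W : ∀ {z} → W₁ z → W z) (W₂⊆W : ∀ {z} → W₂ z → W z) where
      private
        choose : ∀ {A B : Set} → Dec A → B → B → B
        choose (yes _) b _ = b
        choose (no _)  _ b = b

        branch : X → Fin n
        branch x = choose (x ∈? xs) (E₁.branch x) (E₂.branch x)

        inner : X → X → List (Fin n)
        inner x y = choose ((x ∈? xs) ×-dec (y ∈? xs)) (E₁.inner x y) (E₂.inner x y)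

        data Branch (x : X) : Fin n → Set where
          left  : x ∈ˡ xs → Branch x (E₁.branch x)
          right : x ∈ˡ ys → Branch x (E₂.branch x)

        data Inner (x y : X) : List (Fin n) → Set where
          left  : On R xs x y → Inner x y (E₁.inner x y)
          right : On R ys x y → Inner x y (E₂.inner x y)

        branch₁ : ∀ {x} → x ∈ˡ xs → branch x ≡ E₁.branch x
        branch₁ {x} x∈ with x ∈? xs
        ... | yes _ = refl
        ... | no x∉ = contradiction x∈ x∉

        branch₂ : ∀ {x} → x ∈ˡ ys → branch x ≡ E₂.branch x
        branch₂ {x} x∈ with x ∈? xs
        ... | yes x∈xs rewrite common x∈xs x∈ = agree
        ... | no _ = refl

        viewB : ∀ {x} → x ∈ˡ zs → Branch x (branch x)
        viewB {x} x∈ with x ∈? xs | cover x∈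
        ... | yes x∈xs | _ = left x∈xs
        ... | no x∉xs  | inj₁ x∈xs = contradiction x∈xs x∉xs
        ... | no _     | inj₂ x∈ys = right x∈ys

        viewI : ∀ {x y} → On R zs x y → Inner x y (inner x y)
        viewI {x} {y} (x∈ , y∈ , r) with x ∈? xs | y ∈? xs | cover x∈ | cover y∈
        ... | yes x∈xs | yes y∈xs | _ | _ = left (x∈xs , y∈xs , r)
        ... | yes x∈xs | no y∉xs | _ | inj₁ y∈xs = contradiction y∈xs y∉xs
        ... | no x∉xs | _ | inj₁ x∈xs | _ = contradiction x∈xs x∉xs
        ... | no _ | no y∉xs | _ | inj₁ y∈xs = contradiction y∈xs y∉xs
        ... | no _ | no _ | inj₂ x∈ys | inj₂ y∈ys = right (x∈ys , y∈ys , r)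
        ... | yes x∈xs | no y∉xs | _ | inj₂ y∈ys with crossing x∈xs y∈ys (inj₁ r)
        ... | inj₁ refl = right (x₀∈ys , y∈ys , r)
        ... | inj₂ refl = contradiction x₀∈xs y∉xs
        viewI {x} {y} (x∈ , y∈ , r) | no x∉xs | yes y∈xs | inj₂ x∈ys | _
          with crossing y∈xs x∈ys (inj₂ r)
        ... | inj₁ refl = right (x∈ys , x₀∈ys , r)
        ... | inj₂ refl = contradiction x₀∈xs x∉xs

        mixed : ∀ {x y} → x ∈ˡ xs → y ∈ˡ ys → E₁.branch x ≡ E₂.branch y → x ≡ y
        mixed x∈ y∈ e with meet (E₁.branch∈ x∈) (subst W₂ (sym e) (E₂.branch∈ y∈))
        ... | eq = trans (E₁.branch-injective x∈ x₀∈xs (trans eq (sym agree)))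
                         (sym (E₂.branch-injective y∈ x₀∈ys (trans (sym e) eq)))

        injective : ∀ {x y a b} → Branch x a → Branch y b → a ≡ b → x ≡ y
        injective (left x∈)  (left y∈)  e = E₁.branch-injective x∈ y∈ e
        injective (left x∈)  (right y∈) e = mixed x∈ y∈ e
        injective (right x∈) (left y∈)  e = sym (mixed y∈ x∈ (sym e))
        injective (right x∈) (right y∈) e = E₂.branch-injective x∈ y∈ e

        new : ∀ {x y l w b z} → Inner x y l → z ∈ˡ l → Branch w b → z ≢ b
        new (left o)  z∈ (left w∈)  e = E₁.inner-new o z∈ w∈ e
        new (right o) z∈ (right w∈) e = E₂.inner-new o z∈ w∈ e
        new (left o)  z∈ (right w∈) e =
          E₁.inner-new o z∈ x₀∈xs (trans (meet (E₁.inner∈ o z∈) (subst W₂ (sym e) (E₂.branch∈ w∈))) (sym agree))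
        new (right o) z∈ (left w∈) e =
          E₂.inner-new o z∈ x₀∈ys (meet (subst W₁ (sym e) (E₁.branch∈ w∈)) (E₂.inner∈ o z∈))

        disjoint : ∀ {x y x′ y′ l l′ z} → Inner x y l → Inner x′ y′ l′ →
                   z ∈ˡ l → z ∈ˡ l′ → x ≡ x′ × y ≡ y′
        disjoint (left o)  (left o′)  z∈ z∈′ = E₁.inner-disjoint o o′ z∈ z∈′
        disjoint (right o) (right o′) z∈ z∈′ = E₂.inner-disjoint o o′ z∈ z∈′
        disjoint (left o)  (right o′) z∈ z∈′ =
          contradiction (meet (E₁.inner∈ o z∈) (E₂.inner∈ o′ z∈′)) (E₂.inner-new o′ z∈′ x₀∈ys)
        disjoint (right o) (left o′)  z∈ z∈′ =
          contradiction (meet (E₁.inner∈ o′ z∈′) (E₂.inner∈ o z∈)) (E₂.inner-new o z∈ x₀∈ys)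

        branchW : ∀ {x a} → Branch x a → W a
        branchW (left x∈)  = W₁⊆W (E₁.branch∈ x∈)
        branchW (right x∈) = W₂⊆W (E₂.branch∈ x∈)

        innerW : ∀ {x y l z} → Inner x y l → z ∈ˡ l → W z
        innerW (left o)  z∈ = W₁⊆W (E₁.inner∈ o z∈)
        innerW (right o) z∈ = W₂⊆W (E₂.inner∈ o z∈)

        unique : ∀ {x y l} → Inner x y l → Unique l
        unique (left o)  = E₁.distinct o
        unique (right o) = E₂.distinct o

        linked : ∀ {x y l} → Inner x y l → Linked _⟶_ (branch x ∷ l ∷ʳ branch y)
        linked (left o@(x∈ , y∈ , _))  rewrite branch₁ x∈ | branch₁ y∈ = E₁.linked o
        linked (right o@(x∈ , y∈ , _)) rewrite branch₂ x∈ | branch₂ y∈ = E₂.linked o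

      -- By `crossing`, both ends of each arc lie in one of the two lists. The sets `W₁` and `W₂`
      -- meet at most in the image of `x₀`, which is a branch vertex of both embeddings and so inner
      -- to no path; hence paths of different embeddings cannot collide.
      glue : Σ (Embedding _⟶_ R W zs) λ e →
             (∀ {x} → x ∈ˡ xs → Embedding.branch e x ≡ E₁.branch x) ×
             (∀ {x} → x ∈ˡ ys → Embedding.branch e x ≡ E₂.branch x)
      glue = record
        { branch = branch ; inner = inner
        ; branch∈ = branchW ∘ viewB
        ; branch-injective = λ x∈ y∈ → injective (viewB x∈) (viewB y∈)
        ; linked = linked ∘ viewI
        ; distinct = unique ∘ viewI
        ; inner∈ = innerW ∘ viewI
        ; inner-new = λ o z∈ w∈ → new (viewI o) z∈ (viewB w∈)
        ; inner-disjoint = λ o o′ → disjoint (viewI o) (viewI o′)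
        } , branch₁ , branch₂

  module _ {Y W : Fin n → Set} {x₀ u : X} {us : List X} (e : Embedding _⟶_ R Y (u ∷ us))
           {v : Fin n} {out back : List (Fin n)} where
    private module E = Embedding e

    module _ (x₀∉ : x₀ ∉ˡ u ∷ us) (irr : ¬ R x₀ x₀)
             (to : ∀ {w} → w ∈ˡ u ∷ us → R x₀ w → w ≡ u ⊎ w ≡ lastOf u us)
             (from : ∀ {w} → w ∈ˡ u ∷ us → R w x₀ → w ≡ u)
             (out-linked : Linked _⟶_ (v ∷ out ∷ʳ E.branch u))
             (back-linked : Linked _⟶_ (E.branch u ∷ back ∷ʳ v))
             (last-arc : v ⟶ E.branch (lastOf u us))
             (out-unique : Unique out) (back-unique : Unique back)
             (out-outside : All (λ z → W z × z ≢ v × ¬ Y z) out)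
             (back-outside : All (λ z → W z × z ≢ v × ¬ Y z × z ∉ˡ out) back)
             (Wv : W v) (v∉Y : ¬ Y v) (Y⊆W : ∀ {z} → Y z → W z) where
      private
        chooseB : ∀ {x} → Dec (x ≡ x₀) → Fin n
        chooseB (yes _)    = v
        chooseB {x} (no _) = E.branch x

        chooseI : ∀ {x y} → Dec (x ≡ x₀) → Dec (y ≡ x₀) → Dec (y ≡ u) → List (Fin n)
        -- In a one-vertex ear the last vertex is `u` itself; its arc from `x₀` is then realized by
        -- `out`, not by the single last arc.
        chooseI (yes _) _ (yes _)      = out
        chooseI (yes _) _ (no _)       = []
        chooseI (no _) (yes _) _       = back
        chooseI {x} {y} (no _) (no _) _ = E.inner x y

        branch : X → Fin n
        branch x = chooseB (x ≟ x₀)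

        inner : X → X → List (Fin n)
        inner x y = chooseI (x ≟ x₀) (y ≟ x₀) (y ≟ u)

        data Branch : X → Fin n → Set where
          root : Branch x₀ v
          old  : ∀ {x} → x ∈ˡ u ∷ us → Branch x (E.branch x)

        data Inner : X → X → List (Fin n) → Set where
          forth  : Inner x₀ u out
          return : Inner u x₀ back
          last   : Inner x₀ (lastOf u us) []
          old    : ∀ {x y} → On R (u ∷ us) x y → Inner x y (E.inner x y)

        viewB : ∀ {x} → x ∈ˡ x₀ ∷ u ∷ us → Branch x (branch x)
        viewB {x} x∈ with x ≟ x₀
        viewB x∈ | yes refl = root
        viewB (here e) | no ne = contradiction e ne
        viewB (there x∈) | no _ = old x∈

        viewI : ∀ {x y} → On R (x₀ ∷ u ∷ us) x y → Inner x y (inner x y)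
        viewI {x} {y} o with x ≟ x₀ | y ≟ x₀ | y ≟ u
        viewI o | yes refl | _ | yes refl = forth
        viewI (_ , here refl , r) | yes refl | _ | no ne = contradiction r irr
        viewI (_ , there y∈ , r) | yes refl | _ | no ne with to y∈ r
        ... | inj₁ e = contradiction e ne
        ... | inj₂ refl = last
        viewI (here e , _ , _) | no ne | _ | _ = contradiction e ne
        viewI (there x∈ , _ , r) | no _ | yes refl | _ with from x∈ r
        ... | refl = return
        viewI (there _ , here e , _) | no _ | no ne | _ = contradiction e ne
        viewI (there x∈ , there y∈ , r) | no _ | no _ | _ = old (x∈ , y∈ , r)

        branch₀ : branch x₀ ≡ v
        branch₀ with x₀ ≟ x₀
        ... | yes _ = refl
        ... | no ne = contradiction refl ne

        branch₁ : ∀ {x} → x ∈ˡ u ∷ us → branch x ≡ E.branch x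
        branch₁ {x} x∈ with x ≟ x₀
        ... | yes refl = contradiction x∈ x₀∉
        ... | no _ = refl

        v≢ : ∀ {x} → x ∈ˡ u ∷ us → v ≢ E.branch x
        v≢ x∈ e = v∉Y (subst Y (sym e) (E.branch∈ x∈))

        injective : ∀ {x y a b} → Branch x a → Branch y b → a ≡ b → x ≡ y
        injective root root _ = refl
        injective root (old y∈) e = contradiction e (v≢ y∈)
        injective (old x∈) root e = contradiction (sym e) (v≢ x∈)
        injective (old x∈) (old y∈) e = E.branch-injective x∈ y∈ e

        branchW : ∀ {x a} → Branch x a → W a
        branchW root = Wv
        branchW (old x∈) = Y⊆W (E.branch∈ x∈)

        linked : ∀ {x y l} → Inner x y l → Linked _⟶_ (branch x ∷ l ∷ʳ branch y)
        linked forth rewrite branch₀ | branch₁ (here {xs = us} (refl {x = u})) = out-linked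
        linked return rewrite branch₀ | branch₁ (here {xs = us} (refl {x = u})) = back-linked
        linked last rewrite branch₀ | branch₁ (lastOf∈ u us) = last-arc ∷ [-]
        linked (old o@(x∈ , y∈ , _)) rewrite branch₁ x∈ | branch₁ y∈ = E.linked o

        unique : ∀ {x y l} → Inner x y l → Unique l
        unique forth = out-unique
        unique return = back-unique
        unique last = []
        unique (old o) = E.distinct o

        innerW : ∀ {x y l z} → Inner x y l → z ∈ˡ l → W z
        innerW forth z∈ = proj₁ (All.lookup out-outside z∈)
        innerW return z∈ = proj₁ (All.lookup back-outside z∈)
        innerW (old o) z∈ = Y⊆W (E.inner∈ o z∈)

        out∉ : ∀ {z} → z ∈ˡ out → ¬ Y z
        out∉ z∈ = proj₂ (proj₂ (All.lookup out-outside z∈))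
        back∉ : ∀ {z} → z ∈ˡ back → ¬ Y z
        back∉ z∈ = proj₁ (proj₂ (proj₂ (All.lookup back-outside z∈)))
        separate : ∀ {z} → z ∈ˡ back → z ∉ˡ out
        separate z∈ = proj₂ (proj₂ (proj₂ (All.lookup back-outside z∈)))

        new : ∀ {x y l w b z} → Inner x y l → z ∈ˡ l → Branch w b → z ≢ b
        new forth z∈ root = proj₁ (proj₂ (All.lookup out-outside z∈))
        new forth z∈ (old w∈) refl = out∉ z∈ (E.branch∈ w∈)
        new return z∈ root = proj₁ (proj₂ (All.lookup back-outside z∈))
        new return z∈ (old w∈) refl = back∉ z∈ (E.branch∈ w∈)
        new (old o) z∈ root refl = v∉Y (E.inner∈ o z∈)
        new (old o) z∈ (old w∈) e = E.inner-new o z∈ w∈ e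

        disjoint : ∀ {x y x′ y′ l l′ z} → Inner x y l → Inner x′ y′ l′ →
                   z ∈ˡ l → z ∈ˡ l′ → x ≡ x′ × y ≡ y′
        disjoint forth forth _ _ = refl , refl
        disjoint forth return z∈ z∈′ = contradiction z∈ (separate z∈′)
        disjoint forth (old o) z∈ z∈′ = contradiction (E.inner∈ o z∈′) (out∉ z∈)
        disjoint return forth z∈ z∈′ = contradiction z∈′ (separate z∈)
        disjoint return return _ _ = refl , refl
        disjoint return (old o) z∈ z∈′ = contradiction (E.inner∈ o z∈′) (back∉ z∈)
        disjoint (old o) forth z∈ z∈′ = contradiction (E.inner∈ o z∈) (out∉ z∈′)
        disjoint (old o) return z∈ z∈′ = contradiction (E.inner∈ o z∈) (back∉ z∈′)
        disjoint (old o) (old o′) z∈ z∈′ = E.inner-disjoint o o′ z∈ z∈′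

      -- `out` and `back` are the two halves of a cycle through `v`, cut at the image of `u`;
      -- together they realize the digon. The last arc of the ear becomes a single arc. By `to` and
      -- `from`, that arc leaves the root.
      addRoot : Σ (Embedding _⟶_ R W (x₀ ∷ u ∷ us)) λ e → Embedding.branch e x₀ ≡ v
      addRoot = record
        { branch = branch ; inner = inner
        ; branch∈ = branchW ∘ viewB
        ; branch-injective = λ x∈ y∈ → injective (viewB x∈) (viewB y∈)
        ; linked = linked ∘ viewI
        ; distinct = unique ∘ viewI
        ; inner∈ = innerW ∘ viewI
        ; inner-new = λ o z∈ w∈ → new (viewI o) z∈ (viewB w∈)
        ; inner-disjoint = λ o o′ → disjoint (viewI o) (viewI o′)
        } , branch₀

-- Gyárfás paths and the ear at a critical vertex

linked-split : ∀ {A : Set} {_⟶_ : A → A → Set} (l : List A) {y r} → Linked _⟶_ (l ++ y ∷ r) →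
               Linked _⟶_ (l ∷ʳ y) × Linked _⟶_ (y ∷ r)
linked-split [] as = [-] , as
linked-split (x ∷ []) (a ∷ as) = a ∷ [-] , as
linked-split (x ∷ z ∷ l) (a ∷ as) = let p , q = linked-split (z ∷ l) as in a ∷ p , q

unique-split : ∀ {A : Set} (l : List A) {y r} → Unique (l ++ y ∷ r) →
               Unique l × Unique r × y ∉ˡ l × y ∉ˡ r × (∀ {z} → z ∈ˡ r → z ∉ˡ l)
unique-split [] (y∉ ∷ u) = [] , u , (λ ()) , (λ y∈ → All.lookup y∉ y∈ refl) , λ _ ()
unique-split (x ∷ l) (x∉ ∷ u) with unique-split l u
... | ul , ur , y∉l , y∉r , dis =
  All.tabulate (λ z∈ → All.lookup x∉ (∈-++⁺ˡ z∈)) ∷ ul , ur ,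
  (λ { (here refl) → All.lookup x∉ (∈-++⁺ʳ l (here refl)) refl ; (there y∈) → y∉l y∈ }) , y∉r ,
  λ { z∈ (here refl) → All.lookup x∉ (∈-++⁺ʳ l (there z∈)) refl ; z∈ (there z∈l) → dis z∈ z∈l }

-- The digraph that R induces on the list is a subdigraph of an oriented path
-- with the vertices in this order.
data PathLike {X : Set} (R : X → X → Set) : List X → Set where
  [_]  : ∀ {u} → ¬ R u u → PathLike R (u ∷ [])
  cons : ∀ {u u′ us} → ¬ R u u → (R u u′ → ¬ R u′ u) → u ∉ˡ u′ ∷ us →
         (∀ {w} → w ∈ˡ us → ¬ R u w × ¬ R w u) → PathLike R (u′ ∷ us) → PathLike R (u ∷ u′ ∷ us)

module Ears {n : ℕ} {_⟶_ : Fin n → Fin n → Set} (_⟶?_ : ∀ x y → Dec (x ⟶ y))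
            {X : Set} (_≟_ : DecidableEquality X) {R : X → X → Set} (R? : ∀ x y → Dec (R x y)) where

  open Walks _⟶_
  open Links _⟶_
  open Colorings _⟶?_
  open Gluing {_⟶_ = _⟶_} _≟_ {R}

  headIrreflexive : ∀ {u us} → PathLike R (u ∷ us) → ¬ R u u
  headIrreflexive [ irr ] = irr
  headIrreflexive (cons irr _ _ _ _) = irr

  module _ {W W′ : Fin n → Set} {u u′ us}
           (e : Embedding _⟶_ R W′ (u′ ∷ us)) {p q : Fin n} {l : List (Fin n)}
           (at-q : Embedding.branch e u′ ≡ q)
           (forth : R u u′ → Linked _⟶_ (p ∷ l ∷ʳ q)) (back : R u′ u → Linked _⟶_ (q ∷ l ∷ʳ p))
           (Wp : W p) (p∉W′ : ¬ W′ p) (inside : All (λ z → W z × z ≢ p × ¬ W′ z) l)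
           (unique : Unique l) (W′⊆W : ∀ {z} → W′ z → W z) where

    -- An embedding of the first edge is glued on at `u′`; path-likeness excludes arcs between `u`
    -- and the vertices after `u′`.
    prepend : PathLike R (u ∷ u′ ∷ us) → Σ (Embedding _⟶_ R W (u ∷ u′ ∷ us)) λ f →
              Embedding.branch f u ≡ p ×
              Embedding.branch f (lastOf u′ us) ≡ Embedding.branch e (lastOf u′ us)
    prepend (cons irr asym u∉ far rest) = combine
            (pair {W = Pair} (λ u≡u′ → u∉ (here u≡u′)) irr (headIrreflexive rest) asym forth back
              (λ p≡q → p∉W′ (subst W′ (sym p≡q) W′q)) (inj₁ refl) (inj₂ (inj₁ refl))
              (All.tabulate λ z∈ → let _ , z≢p , z∉W′ = All.lookup inside z∈ in
                inj₂ (inj₂ z∈) , z≢p , λ z≡q → z∉W′ (subst W′ (sym z≡q) W′q)) unique)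
      where
      Pair : Fin n → Set
      Pair z = z ≡ p ⊎ z ≡ q ⊎ z ∈ˡ l
      W′q : W′ q
      W′q = subst W′ at-q (Embedding.branch∈ e (here refl))
      common : ∀ {z} → z ∈ˡ u ∷ u′ ∷ [] → z ∈ˡ u′ ∷ us → z ≡ u′
      common (here refl) z∈ = contradiction z∈ u∉
      common (there (here z≡)) _ = z≡
      cover : ∀ {z} → z ∈ˡ u ∷ u′ ∷ us → z ∈ˡ u ∷ u′ ∷ [] ⊎ z ∈ˡ u′ ∷ us
      cover (here z≡)  = inj₁ (here z≡)
      cover (there z∈) = inj₂ z∈
      crossing : ∀ {x y} → x ∈ˡ u ∷ u′ ∷ [] → y ∈ˡ u′ ∷ us → R x y ⊎ R y x → x ≡ u′ ⊎ y ≡ u′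
      crossing (there (here x≡)) _ _ = inj₁ x≡
      crossing (here refl) (here y≡) _ = inj₂ y≡
      crossing (here refl) (there y∈) (inj₁ r) = contradiction r (proj₁ (far y∈))
      crossing (here refl) (there y∈) (inj₂ r) = contradiction r (proj₂ (far y∈))
      meet : ∀ {z} → Pair z → W′ z → z ≡ Embedding.branch e u′
      meet (inj₁ refl) w = contradiction w p∉W′
      meet (inj₂ (inj₁ z≡q)) _ = trans z≡q (sym at-q)
      meet (inj₂ (inj₂ z∈)) w = contradiction w (proj₂ (proj₂ (All.lookup inside z∈)))
      Pair⊆W : ∀ {z} → Pair z → W z
      Pair⊆W (inj₁ refl) = Wp
      Pair⊆W (inj₂ (inj₁ refl)) = W′⊆W W′q
      Pair⊆W (inj₂ (inj₂ z∈)) = proj₁ (All.lookup inside z∈)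
      combine : (Σ (Embedding _⟶_ R Pair (u ∷ u′ ∷ [])) λ f →
                 Embedding.branch f u ≡ p × Embedding.branch f u′ ≡ q) → _
      combine (f , f-u , f-u′) with glue f e (there (here refl)) (here refl) common cover crossing
                                      (trans f-u′ (sym at-q)) meet Pair⊆W W′⊆W
      ... | g , left , right = g , trans (left (here refl)) f-u , right (lastOf∈ u′ us)

  record OrientedLink (K : Subset n) (S T : Fin n → Set) (u u′ : X) : Set where
    field
      {p q}  : Fin n
      {l}    : List (Fin n)
      p∈     : p ∈ K × S p
      q∈     : q ∈ K × T q
      forth  : R u u′ → Linked _⟶_ (p ∷ l ∷ʳ q)
      back   : R u′ u → Linked _⟶_ (q ∷ l ∷ʳ p)
      inside : All (λ z → z ∈ K × ¬ S z × ¬ T z) l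
      unique : Unique l

  -- A strong set contains links both ways, so the direction can follow `R`. If neither arc exists,
  -- the link from `T` to `S` is taken, since its ends are still wanted.
  orientedLink : ∀ {K S T} → Strong K → Decidable S → Decidable T → (∀ {z} → S z → ¬ T z) →
    ∀ {s t} → s ∈ K → S s → t ∈ K → T t → ∀ {u u′} → (R u u′ → ¬ R u′ u) → OrientedLink K S T u u′
  orientedLink strong S? T? disjoint s∈ Ss t∈ Tt {u} {u′} asym with R? u u′
  ... | yes r = record
    { p∈ = source∈ ; q∈ = target∈ ; forth = λ _ → chain ; back = λ r′ → contradiction r′ (asym r)
    ; inside = inside ; unique = distinct }
    where open Link (link S? T? disjoint (strong _ _ s∈ t∈) Ss Tt)
  ... | no ¬r = record
    { p∈ = target∈ ; q∈ = source∈ ; forth = λ r → contradiction r ¬r ; back = λ _ → chain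
    ; inside = All.map (λ (k , t , s) → k , s , t) inside ; unique = distinct }
    where open Link (link T? S? (λ t s → disjoint s t) (strong _ _ t∈ s∈) Tt Ss)

  module _ {N : Fin n → Set} (N? : Decidable N) where

    PathTo-N : Subset n → X → List X → Fin n → Set
    PathTo-N K u us q = Σ (Embedding _⟶_ R (_∈ K) (u ∷ us)) λ e →
      Embedding.branch e u ≡ q × N (Embedding.branch e (lastOf u us))

    -- The link between `q` and `L` decides which vertex of `L` it meets, so `rest` must offer a
    -- path from every vertex of `L`.
    extendPath : ∀ {u u′ us K L q t} → PathLike R (u ∷ u′ ∷ us) → Strong K → L ⊆ K →
                 q ∈ K → q ∉ L → t ∈ L → (∀ {q′} → q′ ∈ L → PathTo-N L u′ us q′) →
                 PathTo-N K u (u′ ∷ us) q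
    extendPath {u} {u′} {us} {K} {L} {q} path@(cons _ asym _ _ _) strong L⊆K q∈K q∉L t∈L rest =
      conclude (rest (proj₂ q′∈))
      where
      oriented : OrientedLink K (_≡ q) (_∈ L) u u′
      oriented = orientedLink strong (Fin._≟ q) (_∈ˢ? L) (λ { refl → q∉L }) q∈K refl (L⊆K t∈L) t∈L asym
      open OrientedLink oriented renaming (q to q′; q∈ to q′∈)
      p≡q : p ≡ q
      p≡q = proj₂ p∈
      conclude : PathTo-N L u′ us q′ → PathTo-N K u (u′ ∷ us) q
      conclude (e , e-u′ , N-last) = finish (prepend e e-u′ forth back (proj₁ p∈)
          (λ p∈L → q∉L (subst (_∈ L) p≡q p∈L))
          (All.map (λ (z∈K , z≢q , z∉L) → z∈K , (λ z≡p → z≢q (trans z≡p p≡q)) , z∉L) inside)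
          unique L⊆K path)
        where
        finish : (Σ (Embedding _⟶_ R (_∈ K) (u ∷ u′ ∷ us)) λ f → Embedding.branch f u ≡ p ×
                  Embedding.branch f (lastOf u′ us) ≡ Embedding.branch e (lastOf u′ us)) →
                 PathTo-N K u (u′ ∷ us) q
        finish (f , f-u , f-last) = f , trans f-u p≡q , subst N (sym f-last) N-last

    -- Each vertex of the path spends one color: its class is deleted, and the path moves on
    -- to a strong part of the rest that is still saturated.
    gyárfásPath : ∀ {u us} → PathLike R (u ∷ us) → ∀ K (c : Fin n → Fin (suc (length us))) {q} →
      Strong K → Proper c K → Saturated N? (length us) K → q ∈ K → PathTo-N K u us q
    gyárfásPath {u} [ irr ] K c {q} strong proper sat q∈K =
      -- A strong set with a proper coloring in one color is a single vertex; saturation puts it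
      -- into `N`.
      singleton u q irr q∈K , refl , decidable-stable (N? q) λ ¬Nq → sat (c , proper ,
        λ { a Na (a∈K , _) → ¬Nq (subst N (sym (q≡ a∈K)) Na) })
      where
      monochromatic : ∀ {x y} → Walk (_∈ K) x y → Walk (Class c K zero) x y
      monochromatic = mapWalk λ {x} x∈ → x∈ , only (c x)
        where
        only : (i : Fin 1) → i ≡ zero
        only zero = refl
      q≡ : ∀ {a} → a ∈ K → q ≡ a
      q≡ a∈K with lastStep (strong _ _ q∈K a∈K)
      ... | inj₁ e = e
      ... | inj₂ (z , w , b) =
        contradiction b (proper zero _ _ (monochromatic (append (strong _ _ a∈K q∈K) w)))
    gyárfásPath path@(cons _ _ _ _ rest) K c {q} strong proper sat q∈K
      with removeClass N? K c (c q) proper sat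
    ... | L , L⊆K , other , strongL , satL , (d , properL) , (t , t∈L) =
      extendPath path strong L⊆K q∈K (λ q∈L → other q∈L refl) t∈L
        (gyárfásPath rest L d strongL properL satL)

    -- `cs` is the cycle without `v`. The ear leaves it at `y`, and `α` and `β` become the interiors
    -- of the two paths for the digon; the embedding must avoid these but contains `y`.
    record OnCycle (H : Subset n) (cs : List (Fin n)) (u : X) (us : List X) : Set where
      field
        {y}       : Fin n
        {α β}     : List (Fin n)
        split     : cs ≡ α ++ y ∷ β
        embedding : Embedding _⟶_ R (λ z → z ∈ H × z ∉ˡ α × z ∉ˡ β) (u ∷ us)
        at-y      : Embedding.branch embedding u ≡ y
        at-last   : N (Embedding.branch embedding (lastOf u us))

    module _ {H K : Subset n} (K⊆H : K ⊆ H) (strong : Strong K) {a : Fin n} {cs : List (Fin n)}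
             (a∈K : a ∈ K) (Na : N a) (a∈cs : a ∈ˡ cs) (unique-cs : Unique cs) where

      -- The whole cycle is one side of the link, so the link touches it only at its end `p`, where
      -- `u` is placed. The vertex `a` guarantees that the cycle meets `K`.
      extendFromCycle : ∀ {u u′ us L t} → PathLike R (u ∷ u′ ∷ us) → L ⊆ K →
        (∀ {z} → z ∈ˡ cs → z ∉ L) → t ∈ L → (∀ {q} → q ∈ L → PathTo-N L u′ us q) →
        OnCycle H cs u (u′ ∷ us)
      extendFromCycle {u} {u′} {us} {L} path@(cons _ asym _ _ _) L⊆K cs∩L t∈L rest =
        conclude (rest (proj₂ q∈)) (∈-∃++ (proj₂ p∈))
        where
        oriented : OrientedLink K (_∈ˡ cs) (_∈ L) u u′
        oriented = orientedLink strong (λ z → DecMem._∈?_ Fin._≟_ z cs) (_∈ˢ? L) cs∩L a∈K a∈cs (L⊆K t∈L) t∈L asym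
        open OrientedLink oriented
        conclude : PathTo-N L u′ us q → (∃₂ λ α β → cs ≡ α ++ p ∷ β) → OnCycle H cs u (u′ ∷ us)
        conclude (e , e-u′ , N-last) (α , β , eq) = onCycle
          (prepend {W = Y} e e-u′ forth back (K⊆H (proj₁ p∈) , p∉α , p∉β) (cs∩L (proj₂ p∈))
            (All.map (λ (z∈K , z∉cs , z∉L) → inY z∈K z∉cs , (λ { refl → z∉cs (proj₂ p∈) }) , z∉L) inside)
            unique (λ z∈L → inY (L⊆K z∈L) (λ z∈cs → cs∩L z∈cs z∈L)) path)
          where
          Y : Fin n → Set
          Y z = z ∈ H × z ∉ˡ α × z ∉ˡ β
          p∉ : p ∉ˡ α × p ∉ˡ β
          p∉ = let _ , _ , ∉α , ∉β , _ = unique-split α (subst Unique eq unique-cs) in ∉α , ∉β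
          p∉α = proj₁ p∉
          p∉β = proj₂ p∉
          inY : ∀ {z} → z ∈ K → z ∉ˡ cs → Y z
          inY z∈K z∉cs = K⊆H z∈K , (λ z∈ → z∉cs (subst (_ ∈ˡ_) (sym eq) (∈-++⁺ˡ z∈))) ,
                                   (λ z∈ → z∉cs (subst (_ ∈ˡ_) (sym eq) (∈-++⁺ʳ α (there z∈))))
          onCycle : (Σ (Embedding _⟶_ R Y (u ∷ u′ ∷ us)) λ f → Embedding.branch f u ≡ p ×
                     Embedding.branch f (lastOf u′ us) ≡ Embedding.branch e (lastOf u′ us)) →
                    OnCycle H cs u (u′ ∷ us)
          onCycle (f , f-u , f-last) = record
            { split = eq ; embedding = f ; at-y = f-u ; at-last = subst N (sym f-last) N-last }

      pathOnCycle : ∀ {u us} → PathLike R (u ∷ us) → (c : Fin n → Fin (suc (length us))) →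
        Proper c K → Saturated N? (length us) K → (∀ {z} → z ∈ˡ cs → z ∈ K → c z ≡ zero) →
        OnCycle H cs u us
      -- A one-vertex ear needs no path away from the cycle: `a` lies on the cycle and in `N`.
      pathOnCycle {u} [ irr ] _ _ _ _ with ∈-∃++ a∈cs
      ... | α , β , eq with unique-split α (subst Unique eq unique-cs)
      ... | _ , _ , a∉α , a∉β , _ = record
        { split = eq ; embedding = singleton u a irr (K⊆H a∈K , a∉α , a∉β) ; at-y = refl ; at-last = Na }
      pathOnCycle path@(cons _ _ _ _ rest) c proper sat cs-zero with removeClass N? K c zero proper sat
      ... | L , L⊆K , nonzero , strongL , satL , (d , properL) , (t , t∈L) =
        extendFromCycle path L⊆K (λ z∈cs z∈L → nonzero z∈L (cs-zero z∈cs (L⊆K z∈L))) t∈L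
          (gyárfásPath rest L d strongL properL satL)

  module _ (⟶-irreflexive : ∀ x → ¬ (x ⟶ x)) {H H⁺ : Subset n} {v : Fin n}
           (v∉H : v ∉ H) (H⁺-split : ∀ {z} → z ∈ H⁺ → z ≡ v ⊎ z ∈ H)
           {x₀ u : X} {us : List X} (path : PathLike R (u ∷ us))
           (c : Fin n → Fin (suc (length us))) (proper : Proper c H)
           (critical : ∀ (d : Fin n → Fin (suc (length us))) → ¬ Proper d H⁺) where

    private
      m : ℕ
      m = length us

      N? : Decidable (v ⟶_)
      N? = v ⟶?_

      open Splitting H N? (_⟶? v)

      -- An avoiding coloring of `H` would extend to `v` with color zero: a closed walk of that
      -- color through `v` would contain a walk of color zero in `H` from an out-neighbor to an
      -- in-neighbor of `v`.
      unavoidable : Unavoidable m H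
      unavoidable (d , pd , avoid) = critical e pe
        where
        choose : ∀ {z} → Dec (z ≡ v) → Fin (suc m)
        choose (yes _)    = zero
        choose {z} (no _) = d z
        e : Fin n → Fin (suc m)
        e z = choose (z Fin.≟ v)
        toH : ∀ {j z} → Class e H⁺ j z × z ≢ v → Class d H j z
        toH {j} {z} ((z∈ , eq) , z≢v) with z Fin.≟ v | H⁺-split z∈
        ... | yes z≡v | _        = contradiction z≡v z≢v
        ... | no _    | inj₁ z≡v = contradiction z≡v z≢v
        ... | no _    | inj₂ z∈H = z∈H , eq
        at-v : ∀ {j} → Class e H⁺ j v → j ≡ zero
        at-v (_ , eq) with v Fin.≟ v
        ... | yes _ = sym eq
        ... | no ne = contradiction refl ne
        throughV : ∀ {j x y} → Class e H⁺ j v → v ⟶ x → y ⟶ v →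
                   ¬ Walk (λ z → Class e H⁺ j z × z ≢ v) x y
        throughV cl a b w with at-v cl
        ... | refl = avoid _ _ a (inj₁ b) (mapWalk toH w)
        pe : Proper e H⁺
        pe j x y w a with visits v w
        ... | inj₁ w′ = pd j x y (mapWalk toH w′) a
        -- The closed walk is rotated so that it runs from its last visit to `v` over the closing
        -- arc to its first visit.
        ... | inj₂ cl with beforeFirstVisit v w | afterLastVisit v w
        ... | inj₁ w′ | _ = pd j x y (mapWalk toH w′) a
        ... | _ | inj₁ w′ = pd j x y (mapWalk toH w′) a
        ... | inj₂ (inj₁ refl) | inj₂ (inj₁ refl) = ⟶-irreflexive _ a
        ... | inj₂ (inj₁ refl) | inj₂ (inj₂ (z , b , r)) = throughV cl b a r
        ... | inj₂ (inj₂ (z , r , b)) | inj₂ (inj₁ refl) = throughV cl a b r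
        ... | inj₂ (inj₂ (z , r , b)) | inj₂ (inj₂ (z′ , b′ , r′)) = throughV cl b′ b (join r′ a r)

      record Cycle (K : Subset n) : Set where
        field
          {a t}  : Fin n
          {cs}   : List (Fin n)
          a∈K    : a ∈ K
          v⟶a    : v ⟶ a
          t⟶v    : t ⟶ v
          route  : IsPath a cs t
          inside : All (λ z → z ∈ H × (z ∈ K → c z ≡ zero)) cs
          unique : Unique cs

      -- The given coloring `c` is proper on `K`, so it fails by admitting a walk of color zero from
      -- `N` to an exit. From there the way to `v` is either an arc or a detour outside `K`, on
      -- which colors are free.
      findCycle : ∀ {K} → K ⊆ H → Unavoidable m K → Cycle K
      findCycle {K} K⊆H un with any? (λ a → any? (λ b →
        N? a ×-dec exit? K b ×-dec walk? _⟶?_ (class? c K zero) a b))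
      ... | no none = ⊥-elim (un (c , proper-⊆ {c = c} {K = H} K⊆H proper , λ a b na eb w → none (a , b , na , eb , w)))
      ... | yes (a , b , na , eb , w) = toCycle eb
        where
        P : Fin n → Set
        P z = z ∈ H × (z ∈ K → c z ≡ zero)
        w′ : Walk P a b
        w′ = mapWalk (λ (z∈K , e) → K⊆H z∈K , λ _ → e) w
        build : ∀ {t} → Walk P a t → t ⟶ v → Cycle K
        build r f with simplify r
        ... | simple p ps u = record
          { a∈K = proj₁ (start w) ; v⟶a = na ; t⟶v = f ; route = p ; inside = ps ; unique = u }
        toCycle : Exit K b → Cycle K
        toCycle (inj₁ f) = build w′ f
        toCycle (inj₂ (_ , f , _ , r , g)) =
          build (join w′ f (mapWalk (λ (h , z∉K) → h , λ z∈K → contradiction z∈K z∉K) r)) g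

    module _ (x₀∉ : x₀ ∉ˡ u ∷ us) (irr : ¬ R x₀ x₀)
             (to : ∀ {w} → w ∈ˡ u ∷ us → R x₀ w → w ≡ u ⊎ w ≡ lastOf u us)
             (from : ∀ {w} → w ∈ˡ u ∷ us → R w x₀ → w ≡ u) where
      private
        Around : Fin n → Set
        Around z = z ≡ v ⊎ z ∈ H

        Rooted : Set
        Rooted = Σ (Embedding _⟶_ R Around (x₀ ∷ u ∷ us)) λ e → Embedding.branch e x₀ ≡ v

        close : ∀ {K} (C : Cycle K) {y α β} → Cycle.cs C ≡ α ++ y ∷ β →
          (e : Embedding _⟶_ R (λ z → z ∈ H × z ∉ˡ α × z ∉ˡ β) (u ∷ us)) →
          Embedding.branch e u ≡ y → v ⟶ Embedding.branch e (lastOf u us) → Rooted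
        close C {α = α} {β} refl e refl last-arc
          with unique-split α (Cycle.unique C)
             | linked-split (v ∷ α) (subst (λ l → Linked _⟶_ (v ∷ l)) (++-assoc α (_ ∷ β) _)
                 (linked (Cycle.v⟶a C) (Cycle.route C) (Cycle.t⟶v C)))
        ... | uα , uβ , _ , _ , dis | lα , lβ = addRoot e x₀∉ irr to from lα lβ last-arc uα uβ
          (All.tabulate λ z∈ → let z∈H , _ = All.lookup (Cycle.inside C) (∈-++⁺ˡ z∈) in
            inj₂ z∈H , (λ { refl → v∉H z∈H }) , λ (_ , z∉α , _) → z∉α z∈)
          (All.tabulate λ z∈ → let z∈H , _ = All.lookup (Cycle.inside C) (∈-++⁺ʳ α (there z∈)) in
            inj₂ z∈H , (λ { refl → v∉H z∈H }) , (λ (_ , _ , z∉β) → z∉β z∈) , dis z∈)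
          (inj₁ refl) (λ (v∈H , _) → v∉H v∈H) (λ (z∈H , _) → inj₂ z∈H)

      rootedEar : Σ (Embedding _⟶_ R (λ z → z ≡ v ⊎ z ∈ H) (x₀ ∷ u ∷ us)) λ e → Embedding.branch e x₀ ≡ v
      rootedEar with strongPart H (⊂-wellFounded H) id unavoidable
      ... | K , K⊆H , strong , un = finish (findCycle K⊆H un)
        where
        start∈ : ∀ {x l y} → IsPath x l y → x ∈ˡ l
        start∈ [ _ ]   = here refl
        start∈ (_ ∷ _) = here refl
        finish : Cycle K → Rooted
        finish C = close C (OnCycle.split D) (OnCycle.embedding D) (OnCycle.at-y D) (OnCycle.at-last D)
          where
          open Cycle C
          D : OnCycle N? H cs u us
          D = pathOnCycle N? K⊆H strong a∈K v⟶a (start∈ route) unique path c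
            (proper-⊆ {c = c} {K = H} K⊆H proper)
            -- Unavoidability gives saturation of the same `K`: if color zero misses `N`, no walk of
            -- color zero starts in `N`.
            (λ (d , pd , avoid) → un (d , pd , λ a b na _ w → avoid a na (start w)))
            (λ z∈ → proj₂ (All.lookup inside z∈))

-- Attaching an ear to an embedded octus

unique-⊆⇒length≤ : ∀ {A : Set} {xs ys : List A} → Unique xs → (∀ {z} → z ∈ˡ xs → z ∈ˡ ys) → length xs ≤ length ys
unique-⊆⇒length≤ {xs = []} _ _ = z≤n
unique-⊆⇒length≤ {xs = x ∷ xs} (x∉ ∷ u) sub with ∈-∃++ (sub (here refl))
... | l , r , refl = subst (suc (length xs) ≤_)
        (sym (trans (length-++ l) (trans (ℕ.+-suc (length l) (length r)) (cong suc (sym (length-++ l))))))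
        (s≤s (unique-⊆⇒length≤ u rest))
  where
  rest : ∀ {z} → z ∈ˡ xs → z ∈ˡ l ++ r
  rest z∈ with ∈-++⁻ l (sub (there z∈))
  ... | inj₁ z∈l = ∈-++⁺ˡ z∈l
  ... | inj₂ (here refl) = contradiction refl (All.lookup x∉ z∈)
  ... | inj₂ (there z∈r) = ∈-++⁺ʳ l z∈r

x∈p─q⇒x∉q : ∀ {n} (p q : Subset n) {x} → x ∈ p ─ q → x ∉ q
x∈p─q⇒x∉q (_ ∷ p) (_ ∷ q) (there x∈) (there x∈q) = x∈p─q⇒x∉q p q x∈ x∈q
x∈p─q⇒x∉q (_ ∷ _) (true ∷ _) () here

module _ {n : ℕ} {_⟶_ : Fin n → Fin n → Set} where
  private
    module Fwd = Walks _⟶_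
    module Bwd = Walks (flip _⟶_)

  reverseWalk : ∀ {P x y} → Bwd.Walk P x y → Fwd.Walk P y x
  reverseWalk (Bwd.here p)     = Fwd.here p
  reverseWalk (Bwd.step p a w) = Fwd.join (reverseWalk w) a (Fwd.here p)

reversePath : ∀ {X : Set} {R : X → X → Set} {us} → PathLike R us → PathLike (flip R) us
reversePath [ irr ] = [ irr ]
reversePath (cons irr asym u∉ far p) =
  cons irr (flip asym) u∉ (λ w∈ → proj₂ (far w∈) , proj₁ (far w∈)) (reversePath p)

module Attaching {n : ℕ} {_⟶_ : Fin n → Fin n → Set} (_⟶?_ : ∀ x y → Dec (x ⟶ y))
                 (⟶-irreflexive : ∀ x → ¬ (x ⟶ x)) where
  open Walks _⟶_ using (Walk; here; step; mapWalk; start)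
  open Colorings _⟶?_

  private
    _⟵_ : Fin n → Fin n → Set
    _⟵_ = flip _⟶_

    module Op = Colorings {_⟶_ = _⟵_} (flip _⟶?_)

    reverseProper : ∀ {m} {c : Fin n → Fin m} {K} → Proper c K → Op.Proper c K
    reverseProper p j x y w a = p j y x (reverseWalk w) a

    unreverseProper : ∀ {m} {c : Fin n → Fin m} {K} → Op.Proper c K → Proper c K
    unreverseProper p j x y w a = p j y x (reverseWalk {_⟶_ = _⟵_} w) a

  -- Nonemptiness is a separate clause: colorings are maps on all of `Fin n`, so for positive `n`
  -- even the empty set needs one color, and the bound alone does not exclude it when `m` is one.
  Hard : Subset n → ℕ → Set
  Hard W m = Nonempty W × (∀ j (c : Fin n → Fin j) → Proper c W → m ≤ j)

  module _ (W : Subset n) (m : ℕ) where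

    Maximal : Subset n → Set
    Maximal A = A ⊆ W × (∃ λ (c : Fin n → Fin (suc m)) → Proper c A) ×
                (∀ {v} → v ∈ W → v ∉ A → ∀ (d : Fin n → Fin (suc m)) → ¬ Proper d (A ∪ ⁅ v ⁆))

    private
      extend : ∀ A → Acc _⊃_ A → A ⊆ W → (c : Fin n → Fin (suc m)) → Proper c A → ∃ Maximal
      extend A (acc rec) A⊆W c pc with any? (λ v → (v ∈ˢ? W) ×-dec ¬? (v ∈ˢ? A) ×-dec
        anyFunction? (λ {f} {g} f≗g → proper-resp {c = f} {g} {A ∪ ⁅ v ⁆} f≗g)
                     (λ (d : Fin n → Fin (suc m)) → proper? d (A ∪ ⁅ v ⁆)))
      ... | no none = A , A⊆W , (c , pc) , λ v∈W v∉A d pd → none (_ , v∈W , v∉A , d , pd)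
      ... | yes (v , v∈W , v∉A , d , pd) = extend (A ∪ ⁅ v ⁆)
              (rec (p⊆p∪q ⁅ v ⁆ , v , q⊆p∪q A ⁅ v ⁆ (x∈⁅x⁆ v) , v∉A)) sub d pd
        where
        sub : A ∪ ⁅ v ⁆ ⊆ W
        sub z∈ with x∈p∪q⁻ A ⁅ v ⁆ z∈
        ... | inj₁ z∈A = A⊆W z∈A
        ... | inj₂ z∈v rewrite x∈⁅y⁆⇒x≡y v z∈v = v∈W

    maximal : ∃ Maximal
    maximal = extend ⊥ (⊃-wellFounded ⊥) (λ z∈ → contradiction z∈ ∉⊥) (λ _ → zero)
      λ j x y w _ → ∉⊥ (proj₁ (start w))

  -- Disjoint palettes: deleting a set that is colorable with `p` colors lowers the number of colors
  -- needed by at most `p`.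
  combine : ∀ {W A p j} {c : Fin n → Fin p} {d : Fin n → Fin j} → Proper c A → Proper d (W ─ A) →
            ∃ λ (e : Fin n → Fin (p + j)) → Proper e W
  combine {W} {A} {p} {j} {c} {d} pc pd = e , pe
    where
    choose : ∀ {z} → Dec (z ∈ A) → Fin p ⊎ Fin j
    choose {z} (yes _) = inj₁ (c z)
    choose {z} (no _)  = inj₂ (d z)
    e : Fin n → Fin (p + j)
    e z = Fin.join p j (choose (z ∈ˢ? A))
    color : ∀ {i z} → Class e W i z → (∃[ i′ ] splitAt p i ≡ inj₁ i′ × Class c A i′ z) ⊎
                                      (∃[ i′ ] splitAt p i ≡ inj₂ i′ × Class d (W ─ A) i′ z)
    color {z = z} (z∈W , refl) with z ∈ˢ? A
    ... | yes z∈A = inj₁ (c z , splitAt-join p j (inj₁ (c z)) , z∈A , refl)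
    ... | no z∉A  = inj₂ (d z , splitAt-join p j (inj₂ (d z)) , x∈p∧x∉q⇒x∈p─q z∈W z∉A , refl)
    pe : Proper e W
    pe i x y w a with color (start w)
    ... | inj₁ (i′ , eq , _) = pc i′ x y (mapWalk toC w) a
      where
      toC : ∀ {z} → Class e W i z → Class c A i′ z
      toC cl with color cl
      ... | inj₁ (_ , eq′ , cl′) with trans (sym eq) eq′
      ... | refl = cl′
      toC cl | inj₂ (_ , eq′ , _) with trans (sym eq) eq′
      ... | ()
    ... | inj₂ (i′ , eq , _) = pd i′ x y (mapWalk toD w) a
      where
      toD : ∀ {z} → Class e W i z → Class d (W ─ A) i′ z
      toD cl with color cl
      ... | inj₂ (_ , eq′ , cl′) with trans (sym eq) eq′
      ... | refl = cl′
      toD cl | inj₁ (_ , eq′ , _) with trans (sym eq) eq′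
      ... | ()

  module _ {X : Set} (_≟_ : DecidableEquality X) {R : X → X → Set} (R? : ∀ x y → Dec (R x y)) where

    ear-at : ∀ {A v} → v ∉ A → ∀ {x₀ u us} out → PathLike R (u ∷ us) →
      (c : Fin n → Fin (suc (length us))) → Proper c A →
      (∀ (d : Fin n → Fin (suc (length us))) → ¬ Proper d (A ∪ ⁅ v ⁆)) →
      x₀ ∉ˡ u ∷ us → ¬ R x₀ x₀ →
      (∀ {w} → w ∈ˡ u ∷ us → R x₀ w → w ≡ u ⊎ (w ≡ lastOf u us × out ≡ true)) →
      (∀ {w} → w ∈ˡ u ∷ us → R w x₀ → w ≡ u ⊎ (w ≡ lastOf u us × out ≡ false)) →
      Σ (Embedding _⟶_ R (λ z → z ≡ v ⊎ z ∈ A) (x₀ ∷ u ∷ us)) λ e → Embedding.branch e x₀ ≡ v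
    ear-at {A} {v} v∉A {x₀} {u} {us} out path c pc critical x₀∉ irr to from =
      choose out to from
      where
      split : ∀ {z} → z ∈ A ∪ ⁅ v ⁆ → z ≡ v ⊎ z ∈ A
      split z∈ with x∈p∪q⁻ A ⁅ v ⁆ z∈
      ... | inj₁ z∈A = inj₂ z∈A
      ... | inj₂ z∈v = inj₁ (x∈⁅y⁆⇒x≡y v z∈v)
      Rooted : (Fin n → Fin n → Set) → (X → X → Set) → Set
      Rooted _⇒_ S = Σ (Embedding _⇒_ S (λ z → z ≡ v ⊎ z ∈ A) (x₀ ∷ u ∷ us)) λ e → Embedding.branch e x₀ ≡ v
      turn : Rooted _⟵_ (flip R) → Rooted _⟶_ R
      turn (e , at-v) = opposite e , at-v
      -- If the last arc points to x₀, this is an ear of the reversed digraph.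
      choose : ∀ b →
        (∀ {w} → w ∈ˡ u ∷ us → R x₀ w → w ≡ u ⊎ (w ≡ lastOf u us × b ≡ true)) →
        (∀ {w} → w ∈ˡ u ∷ us → R w x₀ → w ≡ u ⊎ (w ≡ lastOf u us × b ≡ false)) → Rooted _⟶_ R
      choose true to from = Ears.rootedEar _⟶?_ _≟_ R? ⟶-irreflexive v∉A split path c pc critical x₀∉ irr
        (λ w∈ r → Sum.map₂ proj₁ (to w∈ r))
        (λ w∈ r → [ id , (λ { (_ , ()) }) ]′ (from w∈ r))
      choose false to from = turn (Ears.rootedEar (flip _⟶?_) _≟_ (flip R?) ⟶-irreflexive v∉A split
        (reversePath path) c (reverseProper {c = c} pc) (λ d pd → critical d (unreverseProper {c = d} pd)) x₀∉ irr
        (λ w∈ r → Sum.map₂ proj₁ (from w∈ r))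
        (λ w∈ r → [ id , (λ { (_ , ()) }) ]′ (to w∈ r)))

    -- `A` accounts for one color per ear vertex, so `W ─ A` remains hard enough for `xs`. The ear
    -- lives in `A` together with the image of `x₀`, so this is the only vertex that the two
    -- embeddings share.
    attach : ∀ {W xs zs x₀ u us} out → x₀ ∈ˡ xs → ¬ R x₀ x₀ → PathLike R (u ∷ us) →
      (∀ {z} → z ∈ˡ u ∷ us → z ∉ˡ xs) →
      (∀ {x y} → x ∈ˡ xs → y ∈ˡ u ∷ us → R x y ⊎ R y x → x ≡ x₀) →
      (∀ {w} → w ∈ˡ u ∷ us → R x₀ w → w ≡ u ⊎ (w ≡ lastOf u us × out ≡ true)) →
      (∀ {w} → w ∈ˡ u ∷ us → R w x₀ → w ≡ u ⊎ (w ≡ lastOf u us × out ≡ false)) →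
      (∀ {z} → z ∈ˡ zs → z ∈ˡ xs ⊎ z ∈ˡ u ∷ us) →
      (∀ {V} → Hard V (length xs) → Embedding _⟶_ R (_∈ V) xs) →
      Hard W (suc (length us) + length xs) → Embedding _⟶_ R (_∈ W) zs
    attach {W} {xs} {zs} {x₀} {u} {us} out x₀∈ irr path apart cross to from cover embed (_ , hard)
      with maximal W (length us)
    ... | A , A⊆W , (c , pc) , critical = result
            (ear-at (outside v∈V) out path c pc (critical (p─q⊆p W A v∈V) (outside v∈V))
              (λ x₀∈us → apart x₀∈us x₀∈) irr to from)
      where
      V : Subset n
      V = W ─ A
      outside : ∀ {z} → z ∈ V → z ∉ A
      outside = x∈p─q⇒x∉q W A
      nonempty : Nonempty V
      -- Otherwise `c` colors all of `W` with one color per ear vertex, which is too few because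
      -- `xs` contains `x₀`.
      nonempty = decidable-stable (any? (_∈ˢ? V)) λ empty → ℕ.<-irrefl refl (ℕ.≤-trans
        (ℕ.m<m+n (suc (length us)) {length xs} (nz x₀∈))
        (hard _ c λ j x y w → pc j x y (mapWalk (λ (z∈W , e) →
          decidable-stable (_ ∈ˢ? A) (λ z∉A → empty (_ , x∈p∧x∉q⇒x∈p─q z∈W z∉A)) , e) w)))
        where
        nz : ∀ {x} {l : List X} → x ∈ˡ l → 0 < length l
        nz (here _)  = s≤s z≤n
        nz (there _) = s≤s z≤n
      hardV : Hard V (length xs)
      hardV = nonempty , λ j d pd → let e , pe = combine {W = W} {c = c} {d} pc pd in
        ℕ.+-cancelˡ-≤ (suc (length us)) _ _ (hard _ e pe)
      e₁ : Embedding _⟶_ R (_∈ V) xs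
      e₁ = embed hardV
      v : Fin n
      v = Embedding.branch e₁ x₀
      v∈V : v ∈ V
      v∈V = Embedding.branch∈ e₁ x₀∈
      result : (Σ (Embedding _⟶_ R (λ z → z ≡ v ⊎ z ∈ A) (x₀ ∷ u ∷ us)) λ e → Embedding.branch e x₀ ≡ v) →
               Embedding _⟶_ R (_∈ W) zs
      result (e₂ , at-v) = proj₁ (Gluing.glue _≟_ e₁ e₂ x₀∈ (here refl) common cover′ crossing (sym at-v) meet
              (p─q⊆p W A) λ { (inj₁ refl) → p─q⊆p W A v∈V ; (inj₂ z∈A) → A⊆W z∈A })
        where
        common : ∀ {z} → z ∈ˡ xs → z ∈ˡ x₀ ∷ u ∷ us → z ≡ x₀
        common _ (here e) = e
        common z∈ (there z∈us) = contradiction z∈ (apart z∈us)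
        cover′ : ∀ {z} → z ∈ˡ zs → z ∈ˡ xs ⊎ z ∈ˡ x₀ ∷ u ∷ us
        cover′ z∈ = Sum.map₂ there (cover z∈)
        crossing : ∀ {x y} → x ∈ˡ xs → y ∈ˡ x₀ ∷ u ∷ us → R x y ⊎ R y x → x ≡ x₀ ⊎ y ≡ x₀
        crossing _ (here e) _ = inj₂ e
        crossing x∈ (there y∈) r = inj₁ (cross x∈ y∈ r)
        meet : ∀ {z} → z ∈ V → z ≡ v ⊎ z ∈ A → z ≡ Embedding.branch e₂ x₀
        meet _ (inj₁ refl) = sym at-v
        meet z∈V (inj₂ z∈A) = contradiction z∈A (outside z∈V)

-- Lists of octus vertices

Sorted : ∀ {n} → List (Fin n) → Set
Sorted = AllPairs Fin._<_

-- If the first vertex of the ear is still listed, it heads the list, so the digon sits where an ear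
-- needs it; otherwise the digon has disappeared with it.
zero-head : ∀ {n} {u : Fin (suc n)} {us} → Sorted (u ∷ us) → zero ∈ˡ u ∷ us → zero ≡ u
zero-head _ (here e) = e
zero-head (u< ∷ _) (there z∈) with All.lookup u< z∈
... | ()

fromℕ-last : ∀ {n} {u : Fin (suc n)} {us} → Sorted (u ∷ us) → fromℕ n ∈ˡ u ∷ us → fromℕ n ≡ lastOf u us
fromℕ-last {us = []} _ (here e) = e
fromℕ-last {n} {us = u′ ∷ us} ((u<u′ ∷ _) ∷ _) (here refl) =
  contradiction u<u′ (ℕ.≤⇒≯ (subst (toℕ u′ ≤_) (sym (toℕ-fromℕ n)) (toℕ≤pred[n] u′)))
fromℕ-last {us = _ ∷ _} (_ ∷ s) (there z∈) = fromℕ-last s z∈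

lastOf-map : ∀ {A B : Set} (f : A → B) u us → lastOf (f u) (map f us) ≡ f (lastOf u us)
lastOf-map f u []       = refl
lastOf-map f _ (u ∷ us) = lastOf-map f u us

module _ (F : Digraph) (v₀ : Vertex F) (m : ℕ) (forward : Fin m → Bool) (out : Bool) where
  open EarAddition F v₀ m forward out hiding (addEar)

  private
    X : Set
    X = Fin (suc m) ⊎ Vertex F

  earArc-position : ∀ {p q} → EarArc (inj₁ p) (inj₁ q) →
    (toℕ q ≡ suc (toℕ p)) ⊎ (toℕ p ≡ suc (toℕ q))
  earArc-position (i , inj₁ (refl , refl , _)) = inj₁ (cong suc (sym (toℕ-inject₁ i)))
  earArc-position (i , inj₂ (refl , refl , _)) = inj₂ (cong suc (sym (toℕ-inject₁ i)))

  earArc-up : ∀ {p q} → p Fin.< q → EarArc (inj₁ p) (inj₁ q) → ∃[ i ] q ≡ suc i × forward i ≡ true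
  earArc-up p<q (i , inj₁ (_ , eq , fw)) = i , eq , fw
  earArc-up p<q (i , inj₂ (refl , refl , _)) = contradiction (ℕ.≤-reflexive (cong suc (toℕ-inject₁ i))) (ℕ.<-asym p<q)

  earArc-down : ∀ {p q} → p Fin.< q → EarArc (inj₁ q) (inj₁ p) → ∃[ i ] q ≡ suc i × forward i ≡ false
  earArc-down p<q (i , inj₂ (eq , _ , bw)) = i , eq , bw
  earArc-down p<q (i , inj₁ (refl , refl , _)) = contradiction (ℕ.≤-reflexive (cong suc (toℕ-inject₁ i))) (ℕ.<-asym p<q)

  earArc-asym : ∀ {p q} → p Fin.< q → EarArc (inj₁ p) (inj₁ q) → ¬ EarArc (inj₁ q) (inj₁ p)
  earArc-asym p<q r r′ with earArc-up p<q r | earArc-down p<q r′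
  ... | _ , refl , fw | _ , refl , bw with trans (sym fw) bw
  ... | ()

  -- Arcs join only neighboring positions, and in a sorted list two entries with another one between
  -- them differ by at least two. Dropping a vertex of the ear thus merely removes edges of the
  -- path.
  sorted⇒pathLike : ∀ {u us} → Sorted (u ∷ us) → PathLike EarArc (map inj₁ (u ∷ us))
  sorted⇒pathLike {u} ([] ∷ []) = [ earArc-irrefl (inj₁ u) ]
  sorted⇒pathLike {u} {u′ ∷ us} (u<@(u<u′ ∷ _) ∷ s@(u′< ∷ _)) =
    cons (earArc-irrefl (inj₁ u)) (earArc-asym u<u′) fresh far (sorted⇒pathLike s)
    where
    fresh : inj₁ u ∉ˡ map inj₁ (u′ ∷ us)
    fresh u∈ with ∈-map⁻ inj₁ u∈
    ... | _ , w∈ , refl = ℕ.<-irrefl refl (All.lookup u< w∈)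
    skip : ∀ {w} → w ∈ˡ us → toℕ w ≢ suc (toℕ u) × toℕ u ≢ suc (toℕ w)
    skip w∈ = (λ e → ℕ.<-irrefl (sym e) (ℕ.≤-trans (s≤s u<u′) (All.lookup u′< w∈))) ,
              (λ e → ℕ.<-asym (All.lookup u< (there w∈)) (ℕ.≤-reflexive (sym e)))
    far : ∀ {w} → w ∈ˡ map inj₁ us → ¬ EarArc (inj₁ u) w × ¬ EarArc w (inj₁ u)
    far w∈ with ∈-map⁻ inj₁ w∈
    ... | w , w∈us , refl =
      (λ r → [ proj₁ (skip w∈us) , proj₂ (skip w∈us) ]′ (earArc-position r)) ,
      (λ r → [ proj₂ (skip w∈us) , proj₁ (skip w∈us) ]′ (earArc-position r))

  module _ {n : ℕ} {_⟶_ : Fin n → Fin n → Set} (_⟶?_ : ∀ x y → Dec (x ⟶ y))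
           (⟶-irreflexive : ∀ x → ¬ (x ⟶ x)) where
    open Attaching _⟶?_ ⟶-irreflexive

    private
      _≟_ : DecidableEquality X
      _≟_ = Sum.≡-dec Fin._≟_ Fin._≟_

    embedEar :
      (∀ {V f fs} → Unique (f ∷ fs) → Hard V (length (f ∷ fs)) → Embedding _⟶_ (Arc F) (_∈ V) (f ∷ fs)) →
      ∀ {W t ts} → Unique (t ∷ ts) → Hard W (length (t ∷ ts)) →
      Embedding _⟶_ EarArc (_∈ W) (t ∷ ts)
    embedEar embedF {W} {t} {ts′} unique (nonempty , hard) = go us fs usSorted fsUnique ∈us ∈fs count
      where
      open DecMem _≟_ using (_∈?_)
      ts = t ∷ ts′
      -- Filtering `allFin` yields the ear vertices in their order along the ear, whatever the order
      -- of `ts`.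
      us = filter (λ p → inj₁ p ∈? ts) (allFin (suc m))
      fs = filter (λ y → inj₂ y ∈? ts) (allFin (order F))

      usSorted : Sorted us
      usSorted = AllPairs.filter⁺ (λ p → inj₁ p ∈? ts) (AllPairs.tabulate⁺-< id)
      fsUnique : Unique fs
      fsUnique = Unique.filter⁺ (λ y → inj₂ y ∈? ts) (Unique.allFin⁺ (order F))
      ∈us : ∀ {p} → inj₁ p ∈ˡ ts → p ∈ˡ us
      ∈us = ∈-filter⁺ (λ p → inj₁ p ∈? ts) (∈-allFin _)
      ∈fs : ∀ {y} → inj₂ y ∈ˡ ts → y ∈ˡ fs
      ∈fs = ∈-filter⁺ (λ y → inj₂ y ∈? ts) (∈-allFin _)

      sorted⇒unique : ∀ {k} {l : List (Fin k)} → Sorted l → Unique l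
      sorted⇒unique [] = []
      sorted⇒unique (a ∷ s) = All.map (λ { l refl → ℕ.<-irrefl refl l }) a ∷ sorted⇒unique s

      count : length us + length fs ≤ length ts
      count = subst (_≤ length ts)
        (trans (length-++ (map inj₁ us)) (cong₂ _+_ (length-map inj₁ us) (length-map inj₂ fs)))
        (unique-⊆⇒length≤ (Unique.++⁺ (Unique.map⁺ Sum.inj₁-injective (sorted⇒unique usSorted))
                                       (Unique.map⁺ Sum.inj₂-injective fsUnique) apart) sub)
        where
        apart : ∀ {z} → ¬ (z ∈ˡ map inj₁ us × z ∈ˡ map inj₂ fs)
        apart (z∈ , z∈′) with ∈-map⁻ inj₁ z∈ | ∈-map⁻ inj₂ z∈′
        ... | _ , _ , refl | _ , _ , ()
        sub : ∀ {z} → z ∈ˡ map inj₁ us ++ map inj₂ fs → z ∈ˡ ts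
        sub z∈ with ∈-++⁻ (map inj₁ us) z∈
        ... | inj₁ z∈us with ∈-map⁻ inj₁ z∈us
        ... | _ , p∈ , refl = proj₂ (∈-filter⁻ (λ p → inj₁ p ∈? ts) {xs = allFin (suc m)} p∈)
        sub z∈ | inj₂ z∈fs with ∈-map⁻ inj₂ z∈fs
        ... | _ , y∈ , refl = proj₂ (∈-filter⁻ (λ y → inj₂ y ∈? ts) {xs = allFin (order F)} y∈)

      old : X → Vertex F
      -- Only the values on vertices of `F` matter; `v₀` is a default.
      old = [ (λ _ → v₀) , id ]′

      old∈ : ∀ {fs : List (Vertex F)} {z} → z ∈ˡ map inj₂ fs → old z ∈ˡ fs
      old∈ z∈ with ∈-map⁻ inj₂ z∈
      ... | _ , y∈ , refl = y∈

      old-injective : ∀ {fs : List (Vertex F)} {x y} → x ∈ˡ map inj₂ fs → y ∈ˡ map inj₂ fs → old x ≡ old y → x ≡ y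
      old-injective x∈ y∈ e with ∈-map⁻ inj₂ x∈ | ∈-map⁻ inj₂ y∈
      ... | _ , _ , refl | _ , _ , refl = cong inj₂ e

      old-arc : ∀ {fs : List (Vertex F)} {x y} → On EarArc (map inj₂ fs) x y → Arc F (old x) (old y)
      old-arc (x∈ , y∈ , r) with ∈-map⁻ inj₂ x∈ | ∈-map⁻ inj₂ y∈
      ... | _ , _ , refl | _ , _ , refl = r

      embedOld : ∀ {f fs V} → Unique (f ∷ fs) → Hard V (length (map inj₂ (f ∷ fs))) →
                 Embedding _⟶_ EarArc (_∈ V) (map inj₂ (f ∷ fs))
      embedOld {f} {fs} {V} u h = pullback old old∈ old-injective old-arc
        (embedF u (subst (Hard V) (length-map inj₂ (f ∷ fs)) h))

      go : ∀ us fs → Sorted us → Unique fs → (∀ {p} → inj₁ p ∈ˡ ts → p ∈ˡ us) →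
           (∀ {y} → inj₂ y ∈ˡ ts → y ∈ˡ fs) → length us + length fs ≤ length ts →
           Embedding _⟶_ EarArc (_∈ W) ts
      go [] [] _ _ c₁ c₂ _ = ⊥-elim (empty t (here refl))
        where
        empty : ∀ z → z ∉ˡ ts
        empty (inj₁ _) z∈ = contradiction (c₁ z∈) λ ()
        empty (inj₂ _) z∈ = contradiction (c₂ z∈) λ ()
      go [] (f ∷ fs) _ u c₁ c₂ le = pullback id sub (λ _ _ e → e) (λ (_ , _ , r) → r)
        (embedOld u (nonempty , λ j c pc → ℕ.≤-trans
          (subst (_≤ length ts) (sym (length-map inj₂ (f ∷ fs))) le) (hard j c pc)))
        where
        sub : ∀ {z} → z ∈ˡ ts → z ∈ˡ map inj₂ (f ∷ fs)
        sub {inj₁ _} z∈ = contradiction (c₁ z∈) λ ()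
        sub {inj₂ _} z∈ = ∈-map⁺ inj₂ (c₂ z∈)
      go (u ∷ []) [] _ _ c₁ c₂ _ = pullback id sub (λ _ _ e → e) (λ (_ , _ , r) → r)
        (Gluing.singleton _≟_ (inj₁ u) (proj₁ nonempty) (earArc-irrefl (inj₁ u)) (proj₂ nonempty))
        where
        sub : ∀ {z} → z ∈ˡ ts → z ∈ˡ inj₁ u ∷ []
        sub {inj₁ _} z∈ = ∈-map⁺ inj₁ (c₁ z∈)
        sub {inj₂ _} z∈ = contradiction (c₂ z∈) λ ()
      -- No old vertex is listed: the first ear vertex plays the smaller octus and the others form
      -- an ear at it. It is adjacent at most to the next one, so the direction `true` of the last
      -- arc is arbitrary.
      go (u ∷ u′ ∷ us) [] s _ c₁ c₂ le with sorted⇒pathLike s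
      ... | cons irr asym u∉ far rest = attach _≟_ earArc? true (here refl) irr rest
              (λ { z∈ (here refl) → u∉ z∈ ; _ (there ()) }) (λ { (here e) _ _ → e ; (there ()) _ _ })
              toHead fromHead cover
              (λ ((x , x∈) , _) → Gluing.singleton _≟_ (inj₁ u) x irr x∈)
              (nonempty , λ j c pc → ℕ.≤-trans (ℕ.≤-reflexive same) (ℕ.≤-trans le (hard j c pc)))
        where
        same : suc (length (map inj₁ us)) + 1 ≡ suc (suc (length us)) + 0
        same = trans (ℕ.+-comm _ 1)
          (trans (cong (λ k → suc (suc k)) (length-map inj₁ us)) (sym (ℕ.+-identityʳ _)))
        toHead : ∀ {w} → w ∈ˡ map inj₁ (u′ ∷ us) → EarArc (inj₁ u) w → w ≡ inj₁ u′ ⊎ (w ≡ _ × true ≡ true)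
        toHead (here e) _ = inj₁ e
        toHead (there w∈) r = contradiction r (proj₁ (far w∈))
        fromHead : ∀ {w} → w ∈ˡ map inj₁ (u′ ∷ us) → EarArc w (inj₁ u) → w ≡ inj₁ u′ ⊎ (w ≡ _ × true ≡ false)
        fromHead (here e) _ = inj₁ e
        fromHead (there w∈) r = contradiction r (proj₂ (far w∈))
        cover : ∀ {z} → z ∈ˡ ts → z ∈ˡ inj₁ u ∷ [] ⊎ z ∈ˡ map inj₁ (u′ ∷ us)
        cover {inj₂ _} z∈ = contradiction (c₂ z∈) λ ()
        cover {inj₁ _} z∈ with c₁ z∈
        ... | here refl = inj₁ (here refl)
        ... | there p∈ = inj₂ (∈-map⁺ inj₁ p∈)
      go (u ∷ us) (f ∷ fs) s uniq c₁ c₂ le = atRoot (chooseRoot (DecMem._∈?_ Fin._≟_ v₀ (f ∷ fs)))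
        where
        Root : Set
        Root = ∃[ y ] y ∈ˡ f ∷ fs × (v₀ ∈ˡ f ∷ fs → v₀ ≡ y)
        chooseRoot : Dec (v₀ ∈ˡ f ∷ fs) → Root
        chooseRoot (yes v₀∈) = v₀ , v₀∈ , λ _ → refl
        -- All arcs between the ear and old vertices involve `v₀`; if it is not listed, none remain
        -- and any old vertex can be the root.
        chooseRoot (no v₀∉)  = f , here refl , λ v₀∈ → contradiction v₀∈ v₀∉
        apart : ∀ {z} → z ∈ˡ map inj₁ (u ∷ us) → z ∉ˡ map inj₂ (f ∷ fs)
        apart z∈ z∈′ with ∈-map⁻ inj₁ z∈ | ∈-map⁻ inj₂ z∈′
        ... | _ , _ , refl | _ , _ , ()
        cover : ∀ {z} → z ∈ˡ ts → z ∈ˡ map inj₂ (f ∷ fs) ⊎ z ∈ˡ map inj₁ (u ∷ us)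
        cover {inj₁ _} z∈ = inj₂ (∈-map⁺ inj₁ (c₁ z∈))
        cover {inj₂ _} z∈ = inj₁ (∈-map⁺ inj₂ (c₂ z∈))
        end : ∀ {p} → p ∈ˡ u ∷ us → p ≡ fromℕ m → inj₁ p ≡ lastOf (inj₁ {B = Vertex F} u) (map inj₁ us)
        end p∈ refl = trans (cong inj₁ (fromℕ-last s p∈)) (sym (lastOf-map inj₁ u us))
        atRoot : Root → Embedding _⟶_ EarArc (_∈ W) ts
        atRoot (y , y∈ , root) = attach _≟_ earArc? out (∈-map⁺ inj₂ y∈) (earArc-irrefl (inj₂ y))
          (sorted⇒pathLike s) apart cross to from cover (embedOld uniq)
          (nonempty , λ j c pc → ℕ.≤-trans (ℕ.≤-reflexive (cong₂ _+_ (cong suc (length-map inj₁ us))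
            (length-map inj₂ (f ∷ fs)))) (ℕ.≤-trans le (hard j c pc)))
          where
          cross : ∀ {x z} → x ∈ˡ map inj₂ (f ∷ fs) → z ∈ˡ map inj₁ (u ∷ us) →
                  EarArc x z ⊎ EarArc z x → x ≡ inj₂ y
          cross x∈ z∈ r with ∈-map⁻ inj₂ x∈ | ∈-map⁻ inj₁ z∈
          cross x∈ z∈ (inj₁ (refl , _)) | _ , x∈fs , refl | _ , _ , refl = cong inj₂ (root x∈fs)
          cross x∈ z∈ (inj₂ (refl , _)) | _ , x∈fs , refl | _ , _ , refl = cong inj₂ (root x∈fs)
          to : ∀ {w} → w ∈ˡ map inj₁ (u ∷ us) → EarArc (inj₂ y) w →
               w ≡ inj₁ u ⊎ (w ≡ lastOf (inj₁ u) (map inj₁ us) × out ≡ true)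
          to w∈ r with ∈-map⁻ inj₁ w∈
          to w∈ (_ , inj₁ refl) | _ , p∈ , refl = inj₁ (cong inj₁ (zero-head s p∈))
          to w∈ (_ , inj₂ (e , o)) | _ , p∈ , refl = inj₂ (end p∈ e , o)
          from : ∀ {w} → w ∈ˡ map inj₁ (u ∷ us) → EarArc w (inj₂ y) →
                 w ≡ inj₁ u ⊎ (w ≡ lastOf (inj₁ u) (map inj₁ us) × out ≡ false)
          from w∈ r with ∈-map⁻ inj₁ w∈
          from w∈ (_ , inj₁ refl) | _ , p∈ , refl = inj₁ (cong inj₁ (zero-head s p∈))
          from w∈ (_ , inj₂ (e , o)) | _ , p∈ , refl = inj₂ (end p∈ e , o)

module _ {n : ℕ} {_⟶_ : Fin n → Fin n → Set} (_⟶?_ : ∀ x y → Dec (x ⟶ y))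
         (⟶-irreflexive : ∀ x → ¬ (x ⟶ x)) where
  open Attaching _⟶?_ ⟶-irreflexive

  -- In the subdigraph case the list is carried into the larger octus without growing. Embedding
  -- that octus as a whole would demand colors for its other vertices too.
  octusEmbedding : ∀ {F} → Octus F → ∀ {W x xs} → Unique (x ∷ xs) → Hard W (length (x ∷ xs)) →
                   Embedding _⟶_ (Arc F) (_∈ W) (x ∷ xs)
  octusEmbedding single {x = zero} {[]} _ ((v , v∈W) , _) = Gluing.singleton Fin._≟_ zero v (λ ()) v∈W
  octusEmbedding single {x = zero} {zero ∷ _} ((0≢0 ∷ _) ∷ _) _ = contradiction refl 0≢0
  octusEmbedding (ear {F} octus v₀ m forward out) {W} {x} {xs} unique hard =
    pullback (splitAt (suc m)) (∈-map⁺ (splitAt (suc m))) (λ _ _ → injective)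
             (λ (_ , _ , r) → toWitness r)
             (embedEar F v₀ m forward out _⟶?_ ⟶-irreflexive (octusEmbedding octus)
               (Unique.map⁺ injective unique) (subst (Hard W) (sym (cong suc (length-map _ xs))) hard))
    where
    injective : ∀ {i j} → splitAt (suc m) {order F} i ≡ splitAt (suc m) j → i ≡ j
    injective {i} {j} e = trans (sym (join-splitAt (suc m) (order F) i))
      (trans (cong (Fin.join (suc m) (order F)) e) (join-splitAt (suc m) (order F) j))
  octusEmbedding (subdigraph octus H⊑F) {W} {x} {xs} unique hard =
    pullback embed (∈-map⁺ embed) (λ _ _ → injective) (λ (_ , _ , r) → preserves r)
             (octusEmbedding octus (Unique.map⁺ injective unique)
               (subst (Hard W) (sym (cong suc (length-map _ xs))) hard))
    where open _⊑_ H⊑F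

-- From an embedding to a contained subdivision

data Adjacent {A : Set} (a b : A) : List A → Set where
  here  : ∀ {l} → Adjacent a b (a ∷ b ∷ l)
  there : ∀ {x l} → Adjacent a b l → Adjacent a b (x ∷ l)

module _ {A : Set} {a b : A} where

  adjacent-linked : ∀ {R : A → A → Set} {l} → Adjacent a b l → Linked R l → R a b
  adjacent-linked here (r ∷ _) = r
  adjacent-linked (there ad) (_ ∷ rs) = adjacent-linked ad rs

  adjacent-∈ : ∀ {l} → Adjacent a b l → a ∈ˡ l × b ∈ˡ l
  adjacent-∈ here       = here refl , there (here refl)
  adjacent-∈ (there ad) = let p , q = adjacent-∈ ad in there p , there q

  adjacent-split : ∀ {l} → Adjacent a b l → ∃₂ λ us vs → l ≡ us ++ a ∷ b ∷ vs
  adjacent-split here = [] , _ , refl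
  adjacent-split (there {x} ad) with adjacent-split ad
  ... | us , vs , refl = x ∷ us , vs , refl

adjacent? : ∀ {n} (a b : Fin n) l → Dec (Adjacent a b l)
adjacent? a b [] = no λ ()
adjacent? a b (_ ∷ []) = no λ { (there ()) }
adjacent? a b (x ∷ y ∷ l) = map′ [ (λ { (refl , refl) → here }) , there ]′
  (λ { here → inj₁ (refl , refl) ; (there ad) → inj₂ ad })
  (((a Fin.≟ x) ×-dec (b Fin.≟ y)) ⊎-dec adjacent? a b (y ∷ l))

linked-from : ∀ {A : Set} {R : A → A → Set} l → (∀ {a b} → Adjacent a b l → R a b) → Linked R l
linked-from [] _ = []
linked-from (_ ∷ []) _ = [-]
linked-from (_ ∷ y ∷ l) f = f here ∷ linked-from (y ∷ l) (f ∘ there)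

lookup-injective : ∀ {A : Set} {l : List A} → Unique l → ∀ {i j} → lookup l i ≡ lookup l j → i ≡ j
lookup-injective (_ ∷ _) {zero} {zero} _ = refl
lookup-injective {l = _ ∷ l} (x∉ ∷ _) {zero} {Fin.suc j} e = contradiction e (All.lookup x∉ (∈-lookup j))
lookup-injective {l = _ ∷ l} (x∉ ∷ _) {Fin.suc i} {zero} e = contradiction (sym e) (All.lookup x∉ (∈-lookup i))
lookup-injective (_ ∷ u) {Fin.suc i} {Fin.suc j} e = cong Fin.suc (lookup-injective u e)

∈⇒nonZero : ∀ {A : Set} {x : A} {l} → x ∈ˡ l → NonZero (length l)
∈⇒nonZero (here _)  = _
∈⇒nonZero (there _) = _

aVertex : ∀ {n} → {{NonZero n}} → Fin n
aVertex {suc _} = zero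

arc? : (D : Digraph) → ∀ x y → Dec (Arc D x y)
arc? D x y = Bool.T? (Digraph.arc D x y)

module _ {D F : Digraph} {W : Vertex D → Set}
         (embedding : Embedding (Arc D) (Arc F) W (allFin (order F))) where
  private
    open Embedding embedding

    on : ∀ {x y} → Arc F x y → On (Arc F) (allFin (order F)) x y
    on a = ∈-allFin _ , ∈-allFin _ , a

    full : Vertex F → Vertex F → List (Vertex D)
    full x y = branch x ∷ inner x y ∷ʳ branch y

    Used : Vertex D → Set
    Used z = (∃[ w ] z ≡ branch w) ⊎ (∃[ x ] ∃[ y ] Arc F x y × z ∈ˡ inner x y)

    used? : ∀ z → Dec (Used z)
    used? z = any? (λ w → z Fin.≟ branch w) ⊎-dec
      any? (λ x → any? λ y → arc? F x y ×-dec DecMem._∈?_ Fin._≟_ z (inner x y))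

    usedVertices : List (Vertex D)
    usedVertices = filter used? (allFin (order D))

    position : ∀ {z} → Used z → z ∈ˡ usedVertices
    position = ∈-filter⁺ used? (∈-allFin _)

    -- `arc-covered` forbids arcs off the paths, so `S` cannot be the induced subdigraph on the used
    -- vertices; it keeps only consecutive pairs.
    UsedArc : Vertex D → Vertex D → Set
    UsedArc a b = ∃[ x ] ∃[ y ] Arc F x y × Adjacent a b (full x y)

    usedArc? : ∀ a b → Dec (UsedArc a b)
    usedArc? a b = any? λ x → any? λ y → arc? F x y ×-dec adjacent? a b (full x y)

    usedArc⇒arc : ∀ {a b} → UsedArc a b → Arc D a b
    usedArc⇒arc (x , y , a , ad) = adjacent-linked ad (linked (on a))

    place : Fin (length usedVertices) → Vertex D
    place = lookup usedVertices

    place-injective : ∀ {i j} → place i ≡ place j → i ≡ j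
    place-injective = lookup-injective (Unique.filter⁺ used? (Unique.allFin⁺ (order D)))

    place-used : ∀ i → Used (place i)
    place-used i = proj₂ (∈-filter⁻ used? {xs = allFin (order D)} (∈-lookup i))

    root : Vertex F
    root = aVertex

    S : Digraph
    S = record
      { order = length usedVertices
      ; nonempty = ∈⇒nonZero (position (inj₁ (root , refl)))
      ; arc = λ i j → ⌊ usedArc? (place i) (place j) ⌋
      ; loopless = λ i a → Digraph.loopless D _ (usedArc⇒arc (toWitness a)) }

    choose : ∀ {z} → Dec (Used z) → Vertex S
    choose (yes u) = index (position u)
    choose (no _)  = index (position (inj₁ (root , refl)))

    unplace : Vertex D → Vertex S
    unplace z = choose (used? z)

    place-unplace : ∀ {z} → Used z → place (unplace z) ≡ z
    place-unplace {z} u with used? z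
    ... | yes u′ = sym (lookup-index (position u′))
    ... | no ¬u  = contradiction u ¬u

    unplace-place : ∀ i → unplace (place i) ≡ i
    unplace-place i = place-injective (place-unplace (place-used i))

    unplace-injective : ∀ {y z} → Used y → Used z → unplace y ≡ unplace z → y ≡ z
    unplace-injective uy uz e = trans (sym (place-unplace uy)) (trans (cong place e) (place-unplace uz))

    branch-used : ∀ {x} → Used (branch x)
    branch-used = inj₁ (_ , refl)

    inner-used : ∀ {x y z} → Arc F x y → z ∈ˡ inner x y → Used z
    inner-used a z∈ = inj₂ (_ , _ , a , z∈)

    full-used : ∀ {x y} → Arc F x y → ∀ {z} → z ∈ˡ full x y → Used z
    full-used a (here refl) = branch-used
    full-used {x} {y} a (there z∈) with ∈-++⁻ (inner x y) z∈
    ... | inj₁ z∈inner     = inner-used a z∈inner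
    ... | inj₂ (here refl) = branch-used

    full-unique : ∀ {x y} → Arc F x y → Unique (full x y)
    full-unique {x} {y} a = All.tabulate fresh ∷ Unique.++⁺ (distinct (on a)) ([] ∷ [])
      λ { (z∈ , here refl) → inner-new (on a) z∈ (∈-allFin y) refl }
      where
      fresh : ∀ {z} → z ∈ˡ inner x y ∷ʳ branch y → branch x ≢ z
      fresh z∈ e with ∈-++⁻ (inner x y) z∈
      ... | inj₁ z∈inner = inner-new (on a) z∈inner (∈-allFin x) (sym e)
      ... | inj₂ (here refl) with branch-injective (∈-allFin x) (∈-allFin y) e
      ... | refl = Digraph.loopless F x a

    map-full : ∀ x y → map unplace (full x y) ≡ unplace (branch x) ∷ map unplace (inner x y) ∷ʳ unplace (branch y)
    map-full x y = cong (unplace (branch x) ∷_) (map-++ unplace (inner x y) (branch y ∷ []))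

    pathS : ∀ {x y} → Arc F x y → Path S (unplace (branch x)) (unplace (branch y))
    pathS {x} {y} a = record
      { interior = map unplace (inner x y)
      ; linked   = subst (Linked (Arc S)) (map-full x y) (Linked.map⁺ (linked-from (full x y) arcS))
      -- `unplace` is injective only on used vertices, so distinctness is pulled back along `place`,
      -- which undoes it there.
      ; distinct = subst Unique (map-full x y) (Unique.map⁻ {f = place} (subst Unique (sym back) (full-unique a))) }
      where
      arcS : ∀ {b c} → Adjacent b c (full x y) → Arc S (unplace b) (unplace c)
      arcS {b} {c} ad = fromWitness (subst₂ UsedArc
        (sym (place-unplace (full-used a (proj₁ (adjacent-∈ ad)))))
        (sym (place-unplace (full-used a (proj₂ (adjacent-∈ ad))))) (x , y , a , ad))
      back : map place (map unplace (full x y)) ≡ full x y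
      back = trans (sym (map-∘ (full x y))) (map-id-local (All.tabulate (place-unplace ∘ full-used a)))

    isSubdivision : IsSubdivision F S
    isSubdivision = record
      { branch = unplace ∘ branch
      ; branch-injective = λ e → branch-injective (∈-allFin _) (∈-allFin _) (unplace-injective branch-used branch-used e)
      ; path = pathS
      ; interior-new = λ a z∈ w e → new a z∈ w e
      ; interior-disjoint = λ a a′ z∈ z∈′ → disjoint a a′ z∈ z∈′
      ; vertex-covered = λ z → covered z (place-used z)
      ; arc-covered = λ {u} {v} r → coveredArc u v (toWitness r)
      }
      where
      new : ∀ {x y} (a : Arc F x y) {z} → z ∈ˡ map unplace (inner x y) → ∀ w → z ≢ unplace (branch w)
      new a z∈ w e with ∈-map⁻ unplace z∈
      ... | _ , y∈ , refl = inner-new (on a) y∈ (∈-allFin w) (unplace-injective (inner-used a y∈) branch-used e)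
      disjoint : ∀ {x y x′ y′} (a : Arc F x y) (a′ : Arc F x′ y′) {z} → z ∈ˡ map unplace (inner x y) →
                 z ∈ˡ map unplace (inner x′ y′) → x ≡ x′ × y ≡ y′
      disjoint a a′ z∈ z∈′ with ∈-map⁻ unplace z∈ | ∈-map⁻ unplace z∈′
      ... | _ , y∈ , refl | _ , y∈′ , e with unplace-injective (inner-used a y∈) (inner-used a′ y∈′) e
      ... | refl = inner-disjoint (on a) (on a′) y∈ y∈′
      covered : ∀ z → Used (place z) → _
      covered z (inj₁ (w , e)) = inj₁ (w , trans (sym (unplace-place z)) (cong unplace e))
      covered z (inj₂ (x , y , a , z∈)) =
        inj₂ (x , y , a , subst (_∈ˡ map unplace (inner x y)) (unplace-place z) (∈-map⁺ unplace z∈))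
      coveredArc : ∀ u v → UsedArc (place u) (place v) → _
      coveredArc u v (x , y , a , ad) with adjacent-split ad
      ... | us , vs , eq = x , y , a , map unplace us , map unplace vs ,
        trans (sym (map-full x y)) (trans (cong (map unplace) eq)
          (trans (map-++ unplace us _) (cong₂ (λ i j → map unplace us ++ i ∷ j ∷ map unplace vs)
            (unplace-place u) (unplace-place v))))

  containsSubdivision : ContainsSubdivision D F
  containsSubdivision = S , isSubdivision , record
    { embed = place ; injective = place-injective ; preserves = λ r → usedArc⇒arc (toWitness r) }

-- Complete digraphs and the two bounds

complete : (n : ℕ) → {{NonZero n}} → Digraph
complete n = record
  { order = n
  ; arc = λ x y → ⌊ ¬? (x Fin.≟ y) ⌋
  ; loopless = λ x a → toWitness a refl }

-- The classes of the identity are single vertices. Conversely, two vertices of one color would form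
-- a monochromatic digon, so every acyclic coloring is injective.
complete-dichromatic : ∀ n → {{_ : NonZero n}} → IsDichromaticNumber (complete n) n
complete-dichromatic n = (id , λ i {x} {y} p all → λ a → toWitness a (ends p all)) ,
                         λ j (c , acyclic) → injective⇒≤ (injective c acyclic)
  where
  ends : ∀ {i x y} (p : Path (complete n) x y) → All (_≡ i) (vertices p) → y ≡ x
  ends {y = y} p (x≡i ∷ all) = trans (All.lookup all (∈-++⁺ʳ (interior p) (here refl))) (sym x≡i)
  injective : ∀ {j} (c : Fin n → Fin j) → (∀ i → AcyclicOn (complete n) (λ v → c v ≡ i)) →
              ∀ {x y} → c x ≡ c y → x ≡ y
  injective c acyclic {x} {y} e with x Fin.≟ y
  ... | yes x≡y = x≡y
  ... | no x≢y  = contradiction (fromWitness (x≢y ∘ sym)) (acyclic (c y) digon (e ∷ refl ∷ []))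
    where
    digon : Path (complete n) x y
    digon = record { interior = [] ; linked = fromWitness x≢y ∷ [-] ; distinct = (x≢y ∷ []) ∷ [] ∷ [] }

module _ (D : Digraph) where
  open Walks (Arc D)
  open Colorings (arc? D)
  open Attaching (arc? D) (Digraph.loopless D)

  linked⇒walk : ∀ {P : Vertex D → Set} {x y} l → Linked (Arc D) (x ∷ l ∷ʳ y) → All P (x ∷ l ∷ʳ y) → Walk P x y
  linked⇒walk []      (a ∷ [-]) (p ∷ q ∷ []) = step p a (here q)
  linked⇒walk (z ∷ l) (a ∷ as)  (p ∷ ps)     = step p a (linked⇒walk l as ps)

  proper⇒acyclic : ∀ {j} (c : Vertex D → Fin j) → Proper c ⊤ → AcyclicColoring D j
  proper⇒acyclic c proper = c , λ i {x} {y} p all → proper i x y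
    (mapWalk (λ e → ∈⊤ , e) (linked⇒walk (interior p) (Path.linked p) all))

  dichromatic⇒hard : ∀ {d k} → IsDichromaticNumber D d → k ≤ d → Hard ⊤ k
  dichromatic⇒hard (_ , least) k≤d = (aVertex , ∈⊤) , λ j c proper → ℕ.≤-trans k≤d (least j (proper⇒acyclic c proper))

  embedList : ∀ {F} → Octus F → ∀ xs → Unique xs → 1 ≤ length xs → Hard ⊤ (length xs) → Embedding (Arc D) (Arc F) (_∈ ⊤) xs
  embedList octus (x ∷ xs) unique _ hard = octusEmbedding (arc? D) (Digraph.loopless D) octus unique hard

theorem7 : (F : Digraph) → Octus F → IsMaderNumber F (order F)
theorem7 F octus = (1≤order F , forces) , least
  where
  1≤order : ∀ D → 1 ≤ order D
  1≤order D = >-nonZero⁻¹ (order D)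
  size : length (allFin (order F)) ≡ order F
  size = length-tabulate {n = order F} id
  forces : Forces F (order F)
  forces D d dichromatic order≤d = containsSubdivision (embedList D octus (allFin (order F)) (Unique.allFin⁺ _)
    (subst (1 ≤_) (sym size) (1≤order F))
    (dichromatic⇒hard D dichromatic (subst (_≤ d) (sym size) order≤d)))
  least : ∀ j → 1 ≤ j × Forces F j → order F ≤ j
  -- The branch vertices of the subdivision are distinct vertices of a digraph with `suc j`
  -- vertices.
  least (suc j) (_ , forced) with forced (complete (suc j)) (suc j) (complete-dichromatic (suc j)) ℕ.≤-refl
  ... | S , subdivision , S⊑K = injective⇒≤ (IsSubdivision.branch-injective subdivision ∘ _⊑_.injective S⊑K)
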